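{- Let $a\ge 0$ be a real number, and let $G$ be a connected simple graph with $n=|V(G)|$ vertices and minimum degree $\delta=\delta(G)$. Let $k\in(0,n)$ be a real number with $\delta\le\frac{n-k}{2}$. If $$\lambda_{1}(aD(G)+A(G))<\varphi(a,n,\delta,k),$$ then $\mu_{f}(G)>\frac{n-k}{2}$.
   Context: Graphs are finite, simple and undirected. $A(G)$ is the adjacency matrix of $G$, $D(G)$ is the diagonal matrix of vertex degrees, and $\lambda_1(M)$ denotes the largest eigenvalue of a real symmetric matrix $M$. A fractional matching of $G$ is a function $f:E(G)\to[0,1]$ such that for every vertex $v$ the sum of $f(e)$ over all edges $e$ incident with $v$ is at most $1$. The fractional matching number is $\mu_f(G)=\max\{\sum_{e\in E(G)}f(e): f \text{ is a fractional matching of } G\}$. For real $a\ge 0$, real $k\in(0,n)$ and an integer $\delta\le\frac{n-k}{2}$, define $\varphi(a,n,\delta,k)=\delta\sqrt{1+\frac{2k}{n-k}}$ if $a=0$; $\varphi(a,n,\delta,k)=\frac{2a\delta n}{n-k}$ if $0<a\le 1$; $\varphi(a,n,\delta,k)=\frac{a\delta(n+k)}{n-k}$ if $a>1$. -}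

module Defs where

open import Algebra.Bundles using (CommutativeRing)
open import Algebra.Structures using (IsCommutativeRing)
import Algebra.Definitions.RawMonoid as RawMonoidDefinitions
import Algebra.Solver.Ring.NaturalCoefficients.Default as Solver
open import Data.Bool.Base using (Bool; true; false; T; if_then_else_)
open import Data.Empty using (⊥-elim)
open import Data.Fin.Base using (Fin)
import Data.Fin.Properties as Fin
open import Data.Fin.Subset using (Subset; ∣_∣)
open import Data.Nat.Base as ℕ using (ℕ)
open import Data.Product using (Σ; ∃; _×_; _,_; proj₁; proj₂)
open import Data.Sum.Base using (inj₁; inj₂)
open import Data.Vec.Base using (tabulate)
open import Data.Vec.Functional using (Vector)
open import Level using (0ℓ)
open import Relation.Binary.Construct.Closure.ReflexiveTransitive using (Star)
import Relation.Binary.Construct.StrictToNonStrict as StrictToNonStrict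
open import Relation.Binary.Core using (Rel)
open import Relation.Binary.Definitions using (Decidable; tri<; tri≈; tri>)
open import Relation.Binary.PropositionalEquality using (_≡_)
open import Relation.Binary.Structures using (IsStrictTotalOrder)
open import Relation.Nullary using (¬_; does; yes; no)
open import Relation.Unary using (Pred)

------------------------------------------------------------------------
-- The real numbers

-- The standard library has no real numbers, so ℝ is given by its usual
-- classical axioms: a Dedekind-complete ordered field, which is unique up to
-- isomorphism.  Trichotomy of _<_ and least upper bounds of arbitrary
-- predicates are the classical forms of the axioms.

record CompleteOrderedField : Set₁ where
  infix  4 _≈_ _<_
  infixl 6 _+_
  infixl 7 _*_
  infix  8 -_
  infix  9 _⁻¹
  field
    Carrier            : Set
    _≈_ _<_            : Rel Carrier 0ℓ
    _+_ _*_            : Carrier → Carrier → Carrier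
    -_                 : Carrier → Carrier
    0# 1#              : Carrier
    isCommutativeRing  : IsCommutativeRing _≈_ _+_ _*_ -_ 0# 1#
    -- The inverse is a total function; 0# ⁻¹ is an unspecified value.
    _⁻¹                : Carrier → Carrier
    ⁻¹-inverseʳ        : ∀ {x} → ¬ (x ≈ 0#) → x * x ⁻¹ ≈ 1#
    isStrictTotalOrder : IsStrictTotalOrder _≈_ _<_
    0<1                : 0# < 1#
    +-monoʳ-<          : ∀ x {y z} → y < z → x + y < x + z
    *-pos              : ∀ {x y} → 0# < x → 0# < y → 0# < x * y

  open StrictToNonStrict _≈_ _<_ public using (_≤_)

  UpperBound : Pred Carrier 0ℓ → Pred Carrier 0ℓ
  UpperBound P b = ∀ x → P x → x ≤ b

  field
    supremum : (P : Pred Carrier 0ℓ) → ∃ P → ∃ (UpperBound P) →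
               ∃ λ s → UpperBound P s × (∀ b → UpperBound P b → s ≤ b)

  commutativeRing : CommutativeRing 0ℓ 0ℓ
  commutativeRing = record { isCommutativeRing = isCommutativeRing }

  open CommutativeRing commutativeRing public
    using (_-_; commutativeSemiring; +-rawMonoid)

  open IsStrictTotalOrder isStrictTotalOrder public using (compare; _≟_; _<?_)

  infix 4 _≤?_
  _≤?_ : Decidable _≤_
  _≤?_ = StrictToNonStrict.decidable′ _≈_ _<_ compare

  infixl 7 _/_
  _/_ : Carrier → Carrier → Carrier
  x / y = x * y ⁻¹

------------------------------------------------------------------------
-- Existence of square roots, from completeness

module SquareRoot (ℝ : CompleteOrderedField) where
  open CompleteOrderedField ℝ
  open CommutativeRing commutativeRing
    using ( refl; sym; trans; +-comm; +-identityʳ; +-identityˡ; *-comm; *-assoc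
          ; *-congˡ; +-congˡ; +-congʳ; zeroʳ; -‿inverseʳ; *-identityʳ
          ; +-assoc; distribˡ )
  open IsStrictTotalOrder isStrictTotalOrder
    using (irrefl; <-respʳ-≈; <-respˡ-≈; isEquivalence; <-resp-≈)
    renaming (trans to <-trans)
  open Solver commutativeSemiring using (solve; _:+_; _:*_; _:=_; con)

  private
    ≤-trans : ∀ {x y z} → x ≤ y → y ≤ z → x ≤ z
    ≤-trans = StrictToNonStrict.trans _≈_ _<_ isEquivalence <-resp-≈ <-trans

    <-≤-trans : ∀ {x y z} → x < y → y ≤ z → x < z
    <-≤-trans = StrictToNonStrict.<-≤-trans _≈_ _<_ <-trans <-respʳ-≈

    ≤-<-trans : ∀ {x y z} → x ≤ y → y < z → x < z
    ≤-<-trans = StrictToNonStrict.≤-<-trans _≈_ _<_ sym <-trans <-respˡ-≈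

    <⇒≱ : ∀ {x y} → x < y → ¬ (y ≤ x)
    <⇒≱ x<y y≤x = irrefl refl (<-≤-trans x<y y≤x)

    -- x < y iff y = x + d for some d > 0
    difference : ∀ {x y} → x < y → ∃ λ d → 0# < d × y ≈ x + d
    difference {x} {y} x<y = d , 0<d , y≈x+d
      where
      d = - x + y
      0<d : 0# < d
      0<d = <-respˡ-≈ (trans (+-comm _ _) (-‿inverseʳ x)) (+-monoʳ-< (- x) x<y)
      y≈x+d : y ≈ x + d
      y≈x+d = sym (trans (sym (+-assoc _ _ _))
                         (trans (+-congʳ (-‿inverseʳ x)) (+-identityˡ y)))

    x<x+d : ∀ {x y d} → 0# < d → y ≈ x + d → x < y
    x<x+d {x} 0<d y≈ = <-respʳ-≈ (sym y≈) (<-respˡ-≈ (+-identityʳ x) (+-monoʳ-< x 0<d))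

    +-cancelˡ-< : ∀ z {x y} → z + x < z + y → x < y
    +-cancelˡ-< z {x} {y} p with compare x y
    ... | tri< x<y _ _ = x<y
    ... | tri≈ _ x≈y _ = ⊥-elim (irrefl (+-congˡ x≈y) p)
    ... | tri> _ _ y<x = ⊥-elim (irrefl refl (<-trans p (+-monoʳ-< z y<x)))

    *-monoʳ-< : ∀ {z x y} → 0# < z → x < y → z * x < z * y
    *-monoʳ-< {z} 0<z x<y with difference x<y
    ... | d , 0<d , y≈ = x<x+d (*-pos 0<z 0<d) (trans (*-congˡ y≈) (distribˡ _ _ _))

    *-cancelˡ-< : ∀ {z x y} → 0# < z → z * x < z * y → x < y
    *-cancelˡ-< {z} {x} {y} 0<z p with compare x y
    ... | tri< x<y _ _ = x<y
    ... | tri≈ _ x≈y _ = ⊥-elim (irrefl (*-congˡ x≈y) p)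
    ... | tri> _ _ y<x = ⊥-elim (irrefl refl (<-trans p (*-monoʳ-< 0<z y<x)))

    +-pos : ∀ {x y} → 0# ≤ x → 0# < y → 0# < x + y
    +-pos {x} 0≤x 0<y = ≤-<-trans 0≤x (x<x+d 0<y refl)

    +-nonneg : ∀ {x y} → 0# ≤ x → 0# ≤ y → 0# ≤ x + y
    +-nonneg 0≤x (inj₁ 0<y) = inj₁ (+-pos 0≤x 0<y)
    +-nonneg 0≤x (inj₂ 0≈y) =
      ≤-trans 0≤x (inj₂ (trans (sym (+-identityʳ _)) (+-congˡ 0≈y)))

    *-nonneg : ∀ {x y} → 0# ≤ x → 0# ≤ y → 0# ≤ x * y
    *-nonneg (inj₁ p) (inj₁ q) = inj₁ (*-pos p q)
    *-nonneg {x} (inj₁ p) (inj₂ q) = inj₂ (trans (sym (zeroʳ x)) (*-congˡ q))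
    *-nonneg {x} {y} (inj₂ p) _ =
      inj₂ (trans (sym (zeroʳ y)) (trans (*-congˡ p) (*-comm y x)))

    square-cancel-≤ : ∀ {x y} → 0# ≤ y → x * x < y * y → x ≤ y
    square-cancel-≤ {x} {y} 0≤y p with compare x y
    ... | tri< x<y _ _ = inj₁ x<y
    ... | tri≈ _ x≈y _ = inj₂ x≈y
    ... | tri> _ _ y<x = ⊥-elim (<⇒≱ p (≤-trans y²≤xy (inj₁ (*-monoʳ-< 0<x y<x))))
      where
      0<x = ≤-<-trans 0≤y y<x
      y²≤xy : y * y ≤ x * y
      y²≤xy with difference y<x
      ... | d , 0<d , x≈y+d with *-nonneg 0≤y (inj₁ 0<d)
      ...   | inj₁ 0<yd = inj₁ (x<x+d 0<yd (trans (*-comm x y) (trans (*-congˡ x≈y+d) (distribˡ _ _ _))))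
      ...   | inj₂ 0≈yd = inj₂ (sym (trans (*-comm x y) (trans (*-congˡ x≈y+d)
                (trans (distribˡ _ _ _) (trans (+-congˡ (sym 0≈yd)) (+-identityʳ _))))))

    -- With c = x + 1, the Newton-like step t = (c s + x) / (s + c) lies
    -- strictly between s and √ x, whichever side of √ x the point s is on.
    module Step {x s} (0≤x : 0# ≤ x) (0≤s : 0# ≤ s) where
      c = x + 1#
      w = s + c
      t = (c * s + x) * w ⁻¹
      e = x * x + x + 1#

      0<c : 0# < c
      0<c = +-pos 0≤x 0<1

      0<w : 0# < w
      0<w = +-pos 0≤s 0<c

      0<e : 0# < e
      0<e = +-pos (+-nonneg (*-nonneg 0≤x 0≤x) 0≤x) 0<1

      wt≈ : w * t ≈ c * s + x
      wt≈ = trans (*-comm w t) (trans (*-assoc _ _ _)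
              (trans (*-congˡ (trans (*-comm _ _)
                (⁻¹-inverseʳ λ w≈0 → irrefl (sym w≈0) 0<w))) (*-identityʳ _)))

      0≤t : 0# ≤ t
      0≤t with compare 0# t
      ... | tri< p _ _ = inj₁ p
      ... | tri≈ _ p _ = inj₂ p
      ... | tri> _ _ t<0 = ⊥-elim (<⇒≱ (<-respʳ-≈ (zeroʳ w) (*-monoʳ-< 0<w t<0))
              (≤-trans (+-nonneg (*-nonneg (inj₁ 0<c) 0≤s) 0≤x) (inj₂ (sym wt≈))))

      wws≈ : w * (w * (t * t)) ≈ (c * s + x) * (c * s + x)
      wws≈ = trans (solve 2 (λ w t → w :* (w :* (t :* t)) := (w :* t) :* (w :* t)) refl w t)
                   (trans (*-congˡ wt≈) (trans (*-comm _ _) (*-congˡ wt≈)))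

      ws≈ : w * s ≈ c * s + s * s
      ws≈ = solve 2 (λ s c → (s :+ c) :* s := c :* s :+ s :* s) refl s c

      above : s * s < x → s < t
      above p = *-cancelˡ-< 0<w
        (<-respˡ-≈ (sym ws≈) (<-respʳ-≈ (sym wt≈) (+-monoʳ-< (c * s) p)))

      below : x < s * s → t < s
      below p = *-cancelˡ-< 0<w
        (<-respʳ-≈ (sym ws≈) (<-respˡ-≈ (sym wt≈) (+-monoʳ-< (c * s) p)))

      -- (c s + x)² = r + e s²  and  x (s + c)² = r + e x  where
      -- r = x s² + 2 c s x + x², because c² = x + e.
      r = x * (s * s) + (c * s * x + c * s * x) + x * x

      lhs≈ : (c * s + x) * (c * s + x) ≈ r + e * (s * s)
      lhs≈ = solve 2 (λ x s →
        let c = x :+ con 1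
            e = x :* x :+ x :+ con 1
            r = x :* (s :* s) :+ (c :* s :* x :+ c :* s :* x) :+ x :* x
        in (c :* s :+ x) :* (c :* s :+ x) := r :+ e :* (s :* s)) refl x s

      rhs≈ : w * (w * x) ≈ r + e * x
      rhs≈ = solve 2 (λ x s →
        let c = x :+ con 1
            e = x :* x :+ x :+ con 1
            r = x :* (s :* s) :+ (c :* s :* x :+ c :* s :* x) :+ x :* x
        in (s :+ c) :* ((s :+ c) :* x) := r :+ e :* x) refl x s

      t²<x : s * s < x → t * t < x
      t²<x p = *-cancelˡ-< 0<w (*-cancelˡ-< 0<w
        (<-respˡ-≈ (sym (trans wws≈ lhs≈)) (<-respʳ-≈ (sym rhs≈)
          (+-monoʳ-< r (*-monoʳ-< 0<e p)))))

      x<t² : x < s * s → x < t * t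
      x<t² p = *-cancelˡ-< 0<w (*-cancelˡ-< 0<w
        (<-respʳ-≈ (sym (trans wws≈ lhs≈)) (<-respˡ-≈ (sym rhs≈)
          (+-monoʳ-< r (*-monoʳ-< 0<e p)))))

  sqrt-exists : ∀ {x} → 0# ≤ x → ∃ λ s → 0# ≤ s × s * s ≈ x
  sqrt-exists {x} 0≤x = s , 0≤s , s²≈x
    where
    P : Pred Carrier 0ℓ
    P y = y * y ≤ x

    P0 : P 0#
    P0 = ≤-trans (inj₂ (zeroʳ 0#)) 0≤x

    x<[x+1]² : x < (x + 1#) * (x + 1#)
    x<[x+1]² = x<x+d (Step.0<e 0≤x 0≤x) (solve 1 (λ x →
      (x :+ con 1) :* (x :+ con 1) := x :+ (x :* x :+ x :+ con 1)) refl x)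

    sup = supremum P (0# , P0)
      (x + 1# , λ y y²≤x → square-cancel-≤ (inj₁ (+-pos 0≤x 0<1)) (≤-<-trans y²≤x x<[x+1]²))

    s   = proj₁ sup
    0≤s = proj₁ (proj₂ sup) 0# P0

    open Step 0≤x 0≤s

    s²≈x : s * s ≈ x
    s²≈x with compare (s * s) x
    ... | tri< p _ _ = ⊥-elim (<⇒≱ (above p) (proj₁ (proj₂ sup) t (inj₁ (t²<x p))))
    ... | tri≈ _ p _ = p
    ... | tri> _ _ p = ⊥-elim (<⇒≱ (below p) (proj₂ (proj₂ sup) t
            λ y y²≤x → square-cancel-≤ 0≤t (≤-<-trans y²≤x (x<t² p))))

------------------------------------------------------------------------
-- Finite simple graphs on the vertex set Fin n

record SimpleGraph (n : ℕ) : Set where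
  field
    adj        : Fin n → Fin n → Bool
    adj-sym    : ∀ u v → adj u v ≡ adj v u
    adj-irrefl : ∀ v → adj v v ≡ false

open SimpleGraph public

module _ {n : ℕ} (G : SimpleGraph n) where

  Adjacent : Rel (Fin n) 0ℓ
  Adjacent u v = T (adj G u v)

  Connected : Set
  Connected = ∀ u v → Star Adjacent u v

  neighbours : Fin n → Subset n
  neighbours v = tabulate (adj G v)

  degree : Fin n → ℕ
  degree v = ∣ neighbours v ∣

  IsMinDegree : ℕ → Set
  IsMinDegree δ = (∃ λ v → degree v ≡ δ) × (∀ v → δ ℕ.≤ degree v)

------------------------------------------------------------------------
-- Spectra and fractional matchings over the reals

module Reals (ℝ : CompleteOrderedField) where
  open CompleteOrderedField ℝ public
  open RawMonoidDefinitions +-rawMonoid public using (sum) renaming (_×_ to _×ᴿ_)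
  open SquareRoot ℝ public using (sqrt-exists)

  fromℕ : ℕ → Carrier
  fromℕ n = n ×ᴿ 1#

  -- Square root of a nonnegative number; 0# on negative arguments.
  infix 8 √_
  √_ : Carrier → Carrier
  √ x with 0# ≤? x
  ... | yes 0≤x = proj₁ (sqrt-exists 0≤x)
  ... | no  _   = 0#

  Matrix : ℕ → Set
  Matrix n = Fin n → Fin n → Carrier

  IsEigenvalue : ∀ {n} → Matrix n → Carrier → Set
  IsEigenvalue {n} M μ = Σ (Vector Carrier n) λ x →
    ¬ (∀ i → x i ≈ 0#) × (∀ i → sum (λ j → M i j * x j) ≈ μ * x i)

  IsLargestEigenvalue : ∀ {n} → Matrix n → Carrier → Set
  IsLargestEigenvalue M μ = IsEigenvalue M μ × (∀ ν → IsEigenvalue M ν → ν ≤ μ)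

  module _ {n : ℕ} (G : SimpleGraph n) where

    adjacencyMatrix : Matrix n
    adjacencyMatrix i j = if adj G i j then 1# else 0#

    degreeMatrix : Matrix n
    degreeMatrix i j = if does (i Fin.≟ j) then fromℕ (degree G i) else 0#

    -- a D(G) + A(G)
    aD+A : Carrier → Matrix n
    aD+A a i j = a * degreeMatrix i j + adjacencyMatrix i j

    -- A function E(G) → [0,1] is represented by its values f u v = f v u on
    -- the edges uv, extended by 0 to the pairs that are not edges.
    record IsFractionalMatching (f : Fin n → Fin n → Carrier) : Set where
      field
        symmetric : ∀ u v → f u v ≈ f v u
        supported : ∀ u v → adj G u v ≡ false → f u v ≈ 0#
        nonneg    : ∀ u v → 0# ≤ f u v
        ≤-one     : ∀ u v → f u v ≤ 1#
        vertex    : ∀ v → sum (λ u → f v u) ≤ 1#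

    -- The sum of f over the edges, each edge {u, v} counted once, with u < v.
    size : (Fin n → Fin n → Carrier) → Carrier
    size f = sum λ u → sum λ v → if does (u Fin.<? v) then f u v else 0#

    IsFractionalMatchingNumber : Carrier → Set
    IsFractionalMatchingNumber μ =
      (∃ λ f → IsFractionalMatching f × size f ≈ μ) ×
      (∀ f → IsFractionalMatching f → size f ≤ μ)

  φ : Carrier → ℕ → ℕ → Carrier → Carrier
  φ a n δ k =
    if does (a ≟ 0#)
    then fromℕ δ * √ (1# + fromℕ 2 * k / (fromℕ n - k))
    else if does (a ≤? 1#)
    then fromℕ 2 * a * fromℕ δ * fromℕ n / (fromℕ n - k)
    else a * fromℕ δ * (fromℕ n + k) / (fromℕ n - k)

{-# OPTIONS --safe #-}

-- If μ_f(G) ≤ (n - k)/2, the fractional Tutte–Berge formula gives a set S such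
-- that G - S has a set I of at least |S| + k isolated vertices.  All of the at
-- least δ|I| edges at I lead to S, so the Rayleigh quotient of aD + A at
-- x 1_S + y 1_I is at least δ|I| (a x² + a y² + 2xy) / (|S| x² + |I| y²), and
-- |I|/|S| ≥ (n + k)/(n - k).  The three cases of φ are three choices of x : y.
--
-- The Rayleigh bound λ₁ ≥ xᵀMx/xᵀx: for the supremum s of the quotients, sI - M
-- is positive semidefinite, and it is singular because a nonsingular
-- semidefinite form is bounded below by a positive multiple of xᵀx (by
-- induction on the dimension, via Schur complements).  So s is an eigenvalue.
--
-- The Tutte–Berge formula: view a maximum f as a matching of the bipartite
-- double cover.  Call a row exposable if it is unsaturated in some maximum
-- matching obtained from f by moving weight between rows.  Columns adjacent to
-- exposable rows are saturated and f matches them to exposable rows only, so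
-- the deficit of f is the number of exposable rows minus the number of columns
-- adjacent to them; the vertices counted on both sides cancel.

module Submission where

open import Defs
open import Algebra.Bundles using (CommutativeRing)
import Algebra.Properties.AbelianGroup as AbelianGroupProperties
import Algebra.Properties.Ring as RingProperties
import Algebra.Properties.Semiring.Mult.TCOptimised as Mult
import Algebra.Properties.Semiring.Sum as SemiringSum
import Algebra.Solver.Ring as RingSolver
open import Algebra.Solver.Ring.AlmostCommutativeRing
  using (_-Raw-AlmostCommutative⟶_; fromCommutativeRing)
open import Data.Bool.Base using (Bool; true; false; T; if_then_else_; _∧_; not)
open import Data.Bool.Properties using (T-≡)
open import Data.Empty using (⊥; ⊥-elim)
open import Data.Fin.Base as Fin using (Fin; zero; suc)
import Data.Fin.Properties as Fin
open import Data.Fin.Subset using (∣_∣)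
open import Data.Integer.Base as ℤ using (ℤ; +_; -[1+_]; _⊖_; _◃_)
import Data.Integer.Properties as ℤ
open import Data.Maybe.Base using (Maybe; just; nothing)
open import Data.Nat.Base as ℕ using (ℕ; zero; suc; z≤n; s≤s)
import Data.Nat.Properties as ℕ
open import Data.Product using (Σ; ∃; _×_; _,_; proj₁; proj₂)
import Data.Sign.Base as Sign
open import Data.Sum.Base using (_⊎_; inj₁; inj₂)
open import Data.Vec.Base using (tabulate)
open import Data.Vec.Functional using (Vector; _∷_)
open import Effect.Monad using (RawMonad)
open import Function.Bundles using (Equivalence)
open import Relation.Binary.Bundles using (StrictPartialOrder)
import Relation.Binary.Construct.StrictToNonStrict as StrictToNonStrict
open import Relation.Binary.Definitions using (tri<; tri≈; tri>)
open import Relation.Binary.PropositionalEquality as ≡ using (_≡_)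
import Relation.Binary.Reasoning.Setoid as SetoidReasoning
import Relation.Binary.Reasoning.StrictPartialOrder as StrictPartialOrderReasoning
open import Relation.Binary.Structures using (IsStrictTotalOrder)
open import Relation.Nullary using (¬_; Dec; does; yes; no)
open import Relation.Nullary.Decidable using (_×-dec_; T?; ¬¬-excluded-middle)
open import Relation.Nullary.Negation using (¬¬-Monad; ¬¬-map)

-- Ring solver with integer coefficients, for identities that involve subtraction.

module IntegerCoefficientSolver {c ℓ} (R : CommutativeRing c ℓ) where
  open CommutativeRing R
  open Mult semiring using (×-homo-+; ×1-homo-*; 1+×) renaming (_×_ to _·_)
  open RingProperties ring
    using (-‿distribˡ-*; -‿distribʳ-*; -0#≈0#; -‿involutive)
  open AbelianGroupProperties +-abelianGroup using (⁻¹-∙-comm)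
  open SetoidReasoning setoid

  private
    ⟦_⟧ : ℤ → Carrier
    ⟦ + n ⟧      = n · 1#
    ⟦ -[1+ n ] ⟧ = - (suc n · 1#)

    -‿homo : ∀ i → ⟦ ℤ.- i ⟧ ≈ - ⟦ i ⟧
    -‿homo (+ zero)  = sym -0#≈0#
    -‿homo (+ suc n) = refl
    -‿homo -[1+ n ]  = sym (-‿involutive _)

    ⊖-homo : ∀ m n → ⟦ m ⊖ n ⟧ ≈ m · 1# - n · 1#
    ⊖-homo zero    zero    = sym (-‿inverseʳ 0#)
    ⊖-homo zero    (suc n) = sym (+-identityˡ _)
    ⊖-homo (suc m) zero    = sym (trans (+-congˡ -0#≈0#) (+-identityʳ _))
    ⊖-homo (suc m) (suc n) = begin
      ⟦ suc m ⊖ suc n ⟧                       ≡⟨ ≡.cong ⟦_⟧ (ℤ.[1+m]⊖[1+n]≡m⊖n m n) ⟩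
      ⟦ m ⊖ n ⟧                               ≈⟨ ⊖-homo m n ⟩
      m · 1# - n · 1#                         ≈⟨ +-identityˡ _ ⟨
      -- Inserting 1 - 1 turns m - n into the difference of the two successors.
      0# + (m · 1# - n · 1#)                  ≈⟨ +-congʳ (-‿inverseʳ 1#) ⟨
      (1# - 1#) + (m · 1# - n · 1#)           ≈⟨ +-assoc _ _ _ ⟩
      1# + (- 1# + (m · 1# - n · 1#))         ≈⟨ +-congˡ (+-assoc _ _ _) ⟨
      1# + ((- 1# + m · 1#) - n · 1#)         ≈⟨ +-congˡ (+-congʳ (+-comm _ _)) ⟩
      1# + ((m · 1# - 1#) - n · 1#)           ≈⟨ +-congˡ (+-assoc _ _ _) ⟩
      1# + (m · 1# + (- 1# - n · 1#))         ≈⟨ +-assoc _ _ _ ⟨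
      (1# + m · 1#) + (- 1# - n · 1#)         ≈⟨ +-congˡ (⁻¹-∙-comm _ _) ⟩
      (1# + m · 1#) - (1# + n · 1#)           ≈⟨ +-cong (1+× m 1#) (-‿cong (1+× n 1#)) ⟨
      suc m · 1# - suc n · 1#                 ∎

    +-homo : ∀ i j → ⟦ i ℤ.+ j ⟧ ≈ ⟦ i ⟧ + ⟦ j ⟧
    +-homo (+ m)    (+ n)    = ×-homo-+ 1# m n
    +-homo (+ m)    -[1+ n ] = ⊖-homo m (suc n)
    +-homo -[1+ m ] (+ n)    = trans (⊖-homo n (suc m)) (+-comm _ _)
    +-homo -[1+ m ] -[1+ n ] = begin
      - (suc (suc (m ℕ.+ n)) · 1#)      ≡⟨ ≡.cong (λ k → - (k · 1#)) (≡.cong suc (ℕ.+-suc m n)) ⟨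
      - ((suc m ℕ.+ suc n) · 1#)        ≈⟨ -‿cong (×-homo-+ 1# (suc m) (suc n)) ⟩
      - (suc m · 1# + suc n · 1#)       ≈⟨ ⁻¹-∙-comm _ _ ⟨
      - (suc m · 1#) - suc n · 1#       ∎

    -- Integer multiplication is computed by `_◃_` from a sign and an absolute value. Zero is split
    -- off because `_◃_` yields + 0 for either sign.
    ◃⁺-homo : ∀ n → ⟦ Sign.+ ◃ n ⟧ ≈ n · 1#
    ◃⁺-homo zero    = refl
    ◃⁺-homo (suc n) = refl

    ◃⁻-homo : ∀ n → ⟦ Sign.- ◃ n ⟧ ≈ - (n · 1#)
    ◃⁻-homo zero    = sym -0#≈0#
    ◃⁻-homo (suc n) = refl

    *-homo : ∀ i j → ⟦ i ℤ.* j ⟧ ≈ ⟦ i ⟧ * ⟦ j ⟧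
    *-homo (+ m)    (+ n)    = trans (◃⁺-homo (m ℕ.* n)) (×1-homo-* m n)
    *-homo (+ m)    -[1+ n ] = begin
      ⟦ Sign.- ◃ m ℕ.* suc n ⟧     ≈⟨ ◃⁻-homo (m ℕ.* suc n) ⟩
      - ((m ℕ.* suc n) · 1#)       ≈⟨ -‿cong (×1-homo-* m (suc n)) ⟩
      - (m · 1# * suc n · 1#)      ≈⟨ -‿distribʳ-* _ _ ⟩
      m · 1# * - (suc n · 1#)      ∎
    *-homo -[1+ m ] (+ n)    = begin
      ⟦ Sign.- ◃ suc m ℕ.* n ⟧     ≈⟨ ◃⁻-homo (suc m ℕ.* n) ⟩
      - ((suc m ℕ.* n) · 1#)       ≈⟨ -‿cong (×1-homo-* (suc m) n) ⟩
      - (suc m · 1# * n · 1#)      ≈⟨ -‿distribˡ-* _ _ ⟩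
      - (suc m · 1#) * n · 1#      ∎
    *-homo -[1+ m ] -[1+ n ] = begin
      (suc m ℕ.* suc n) · 1#               ≈⟨ ×1-homo-* (suc m) (suc n) ⟩
      suc m · 1# * suc n · 1#              ≈⟨ -‿involutive _ ⟨
      - - (suc m · 1# * suc n · 1#)        ≈⟨ -‿cong (-‿distribʳ-* _ _) ⟩
      - (suc m · 1# * - (suc n · 1#))      ≈⟨ -‿distribˡ-* _ _ ⟩
      - (suc m · 1#) * - (suc n · 1#)      ∎

    homomorphism : ℤ.+-*-rawRing -Raw-AlmostCommutative⟶ fromCommutativeRing R
    homomorphism = record
      { ⟦_⟧ = ⟦_⟧ ; +-homo = +-homo ; *-homo = *-homo ; -‿homo = -‿homo
      ; 0-homo = refl ; 1-homo = refl }

    coeff≟ : ∀ i j → Maybe (⟦ i ⟧ ≈ ⟦ j ⟧)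
    coeff≟ i j with i ℤ.≟ j
    ... | yes ≡.refl = just refl
    ... | no  _      = nothing

  open RingSolver _ _ homomorphism coeff≟ public
    using (Polynomial; con; _:+_; _:*_; _:-_; :-_; _:=_; solve)

-- Order, division and density in an ordered field.

module OrderedField (ℝ : CompleteOrderedField) where
  open Reals ℝ
  open CommutativeRing commutativeRing public
    using ( refl; sym; trans; reflexive; setoid; semiring
          ; +-comm; +-identityʳ; +-identityˡ; +-cong; +-congˡ; +-congʳ
          ; *-comm; *-assoc; *-identityʳ; *-identityˡ; *-cong; *-congˡ; *-congʳ
          ; zeroʳ; zeroˡ; distribˡ; distribʳ; -‿inverseʳ; -‿inverseˡ; -‿cong )
  open IsStrictTotalOrder isStrictTotalOrder public
    using (irrefl; <-respʳ-≈; <-respˡ-≈; isStrictPartialOrder)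
    renaming (trans to <-trans)
  open IntegerCoefficientSolver commutativeRing public

  <-strictPartialOrder : StrictPartialOrder _ _ _
  <-strictPartialOrder = record { isStrictPartialOrder = isStrictPartialOrder }

  open StrictPartialOrder <-strictPartialOrder using (<-resp-≈; isEquivalence)

  module ≤-Reasoning = StrictPartialOrderReasoning <-strictPartialOrder

  2# : Carrier
  2# = 1# + 1#

  :0 :1 : ∀ {n} → Polynomial n
  :0 = con (+ 0)
  :1 = con (+ 1)

  ≤-refl : ∀ {x} → x ≤ x
  ≤-refl = inj₂ refl

  ≤-trans : ∀ {x y z} → x ≤ y → y ≤ z → x ≤ z
  ≤-trans = StrictToNonStrict.trans _≈_ _<_ isEquivalence <-resp-≈ <-trans

  <-≤-trans : ∀ {x y z} → x < y → y ≤ z → x < z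
  <-≤-trans = StrictToNonStrict.<-≤-trans _≈_ _<_ <-trans <-respʳ-≈

  ≤-<-trans : ∀ {x y z} → x ≤ y → y < z → x < z
  ≤-<-trans = StrictToNonStrict.≤-<-trans _≈_ _<_ sym <-trans <-respˡ-≈

  ≤-antisym : ∀ {x y} → x ≤ y → y ≤ x → x ≈ y
  ≤-antisym (inj₂ x≈y) _          = x≈y
  ≤-antisym (inj₁ x<y) (inj₂ y≈x) = sym y≈x
  ≤-antisym (inj₁ x<y) (inj₁ y<x) = ⊥-elim (irrefl refl (<-trans x<y y<x))

  <⇒≱ : ∀ {x y} → x < y → ¬ (y ≤ x)
  <⇒≱ x<y y≤x = irrefl refl (<-≤-trans x<y y≤x)

  ≮⇒≥ : ∀ {x y} → ¬ (x < y) → y ≤ x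
  ≮⇒≥ {x} {y} x≮y with compare x y
  ... | tri< x<y _ _ = ⊥-elim (x≮y x<y)
  ... | tri≈ _ x≈y _ = inj₂ (sym x≈y)
  ... | tri> _ _ y<x = inj₁ y<x

  ≰⇒> : ∀ {x y} → ¬ (x ≤ y) → y < x
  ≰⇒> {x} {y} x≰y with compare y x
  ... | tri< y<x _ _ = y<x
  ... | tri≈ _ y≈x _ = ⊥-elim (x≰y (inj₂ (sym y≈x)))
  ... | tri> _ _ x<y = ⊥-elim (x≰y (inj₁ x<y))

  ≤-respʳ : ∀ {x y z} → y ≈ z → x ≤ y → x ≤ z
  ≤-respʳ y≈z x≤y = ≤-trans x≤y (inj₂ y≈z)

  ≤-respˡ : ∀ {x y z} → y ≈ z → y ≤ x → z ≤ x
  ≤-respˡ y≈z y≤x = ≤-trans (inj₂ (sym y≈z)) y≤x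

  x<y⇒0<y-x : ∀ {x y} → x < y → 0# < y - x
  x<y⇒0<y-x {x} {y} x<y =
    <-respˡ-≈ (-‿inverseˡ x) (<-respʳ-≈ (+-comm _ _) (+-monoʳ-< (- x) x<y))

  x≤y⇒0≤y-x : ∀ {x y} → x ≤ y → 0# ≤ y - x
  x≤y⇒0≤y-x     (inj₁ x<y) = inj₁ (x<y⇒0<y-x x<y)
  x≤y⇒0≤y-x {x} (inj₂ x≈y) = inj₂ (trans (sym (-‿inverseʳ x)) (+-congʳ x≈y))

  -- With `x≤x+d`, the usual way to certify an inequality below: d is a visibly positive or
  -- nonnegative expression, and the ring solver checks the identity y = x + d.
  x<x+d : ∀ {x y d} → 0# < d → y ≈ x + d → x < y
  x<x+d {x} 0<d y≈ = <-respʳ-≈ (sym y≈) (<-respˡ-≈ (+-identityʳ x) (+-monoʳ-< x 0<d))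

  x≤x+d : ∀ {x y d} → 0# ≤ d → y ≈ x + d → x ≤ y
  x≤x+d     (inj₁ 0<d) y≈ = inj₁ (x<x+d 0<d y≈)
  x≤x+d {x} (inj₂ 0≈d) y≈ =
    inj₂ (sym (trans y≈ (trans (+-congˡ (sym 0≈d)) (+-identityʳ x))))

  +-mono-≤ : ∀ {x y u v} → x ≤ y → u ≤ v → x + u ≤ y + v
  +-mono-≤ {x} {y} {u} {v} x≤y u≤v = ≤-trans
    (x≤x+d (x≤y⇒0≤y-x x≤y) (solve 3 (λ x y u → y :+ u := (x :+ u) :+ (y :- x)) refl x y u))
    (x≤x+d (x≤y⇒0≤y-x u≤v) (solve 3 (λ y u v → y :+ v := (y :+ u) :+ (v :- u)) refl y u v))

  +-mono-<-≤ : ∀ {x y u v} → x < y → u ≤ v → x + u < y + v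
  +-mono-<-≤ {x} {y} {u} {v} x<y u≤v = <-≤-trans
    (x<x+d (x<y⇒0<y-x x<y) (solve 3 (λ x y u → y :+ u := (x :+ u) :+ (y :- x)) refl x y u))
    (+-mono-≤ ≤-refl u≤v)

  +-nonneg : ∀ {x y} → 0# ≤ x → 0# ≤ y → 0# ≤ x + y
  +-nonneg 0≤x 0≤y = ≤-respˡ (+-identityˡ 0#) (+-mono-≤ 0≤x 0≤y)

  +-pos : ∀ {x y} → 0# < x → 0# ≤ y → 0# < x + y
  +-pos 0<x 0≤y = <-respˡ-≈ (+-identityˡ 0#) (+-mono-<-≤ 0<x 0≤y)

  *-nonneg : ∀ {x y} → 0# ≤ x → 0# ≤ y → 0# ≤ x * y
  *-nonneg (inj₁ p) (inj₁ q) = inj₁ (*-pos p q)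
  *-nonneg {x} {y} p (inj₂ q) = inj₂ (trans (sym (zeroʳ x)) (*-congˡ q))
  *-nonneg {x} {y} (inj₂ p) _ = inj₂ (trans (sym (zeroˡ y)) (*-congʳ p))

  *-monoʳ-≤ : ∀ {z x y} → 0# ≤ z → x ≤ y → z * x ≤ z * y
  *-monoʳ-≤ {z} {x} {y} 0≤z x≤y = x≤x+d (*-nonneg 0≤z (x≤y⇒0≤y-x x≤y))
    (solve 3 (λ z x y → z :* y := z :* x :+ z :* (y :- x)) refl z x y)

  *-monoˡ-≤ : ∀ {z x y} → 0# ≤ z → x ≤ y → x * z ≤ y * z
  *-monoˡ-≤ {z} {x} {y} 0≤z x≤y = x≤x+d (*-nonneg 0≤z (x≤y⇒0≤y-x x≤y))
    (solve 3 (λ z x y → y :* z := x :* z :+ z :* (y :- x)) refl z x y)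

  *-monoʳ-< : ∀ {z x y} → 0# < z → x < y → z * x < z * y
  *-monoʳ-< {z} {x} {y} 0<z x<y = x<x+d (*-pos 0<z (x<y⇒0<y-x x<y))
    (solve 3 (λ z x y → z :* y := z :* x :+ z :* (y :- x)) refl z x y)

  *-cancelˡ-≤ : ∀ {z x y} → 0# < z → z * x ≤ z * y → x ≤ y
  *-cancelˡ-≤ 0<z zx≤zy = ≮⇒≥ λ y<x → <⇒≱ (*-monoʳ-< 0<z y<x) zx≤zy

  *-cancelˡ-< : ∀ {z x y} → 0# < z → z * x < z * y → x < y
  *-cancelˡ-< 0<z zx<zy = ≰⇒> λ y≤x → <⇒≱ zx<zy (*-monoʳ-≤ (inj₁ 0<z) y≤x)

  square-nonneg : ∀ x → 0# ≤ x * x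
  square-nonneg x with compare 0# x
  ... | tri< 0<x _ _ = inj₁ (*-pos 0<x 0<x)
  ... | tri≈ _ 0≈x _ = inj₂ (trans (sym (zeroˡ x)) (*-congʳ 0≈x))
  ... | tri> _ _ x<0 = inj₁ (<-respʳ-≈ (solve 1 (λ x → :- x :* :- x := x :* x) refl x)
                               (*-pos 0<-x 0<-x))
    where
    0<-x : 0# < - x
    0<-x = <-respʳ-≈ (+-identityˡ _) (x<y⇒0<y-x x<0)

  square-pos : ∀ {x} → ¬ (x ≈ 0#) → 0# < x * x
  square-pos {x} x≉0 with square-nonneg x
  ... | inj₁ 0<x² = 0<x²
  ... | inj₂ 0≈x² = ⊥-elim (x≉0 (begin
    x                 ≈⟨ *-identityʳ x ⟨
    x * 1#            ≈⟨ *-congˡ (⁻¹-inverseʳ x≉0) ⟨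
    x * (x * x ⁻¹)    ≈⟨ *-assoc x x _ ⟨
    x * x * x ⁻¹      ≈⟨ *-congʳ 0≈x² ⟨
    0# * x ⁻¹         ≈⟨ zeroˡ _ ⟩
    0#                ∎))
    where open SetoidReasoning setoid

  0≤1 : 0# ≤ 1#
  0≤1 = inj₁ 0<1

  0<2 : 0# < 2#
  0<2 = +-pos 0<1 0≤1

  0<⇒≉0 : ∀ {x} → 0# < x → ¬ (x ≈ 0#)
  0<⇒≉0 0<x x≈0 = irrefl (sym x≈0) 0<x

  x*y/y≈x : ∀ {y} x → 0# < y → y * (x / y) ≈ x
  x*y/y≈x {y} x 0<y = begin
    y * (x * y ⁻¹)   ≈⟨ solve 3 (λ x y z → y :* (x :* z) := x :* (y :* z)) refl x y (y ⁻¹) ⟩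
    x * (y * y ⁻¹)   ≈⟨ *-congˡ (⁻¹-inverseʳ (0<⇒≉0 0<y)) ⟩
    x * 1#           ≈⟨ *-identityʳ x ⟩
    x                ∎
    where open SetoidReasoning setoid

  /-pos : ∀ {x y} → 0# < x → 0# < y → 0# < x / y
  /-pos {x} {y} 0<x 0<y = *-cancelˡ-< 0<y
    (<-respˡ-≈ (sym (zeroʳ y)) (<-respʳ-≈ (sym (x*y/y≈x x 0<y)) 0<x))

  dense : ∀ {x y} → x < y → ∃ λ z → x < z × z < y
  dense {x} {y} x<y = (x + y) / 2#
    , *-cancelˡ-< 0<2 (<-respʳ-≈ (sym (x*y/y≈x _ 0<2)) (x<x+d (x<y⇒0<y-x x<y)
        (solve 2 (λ x y → x :+ y := (:1 :+ :1) :* x :+ (y :- x)) refl x y)))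
    , *-cancelˡ-< 0<2 (<-respˡ-≈ (sym (x*y/y≈x _ 0<2)) (x<x+d (x<y⇒0<y-x x<y)
        (solve 2 (λ x y → (:1 :+ :1) :* y := (x :+ y) :+ (y :- x)) refl x y)))

  -- Supplies the amount of weight to move in the matching arguments, where it must fit into two
  -- gaps at once.
  smaller-than-both : ∀ {x y} → 0# < x → 0# < y → ∃ λ z → 0# < z × z < x × z < y
  smaller-than-both {x} {y} 0<x 0<y with compare x y
  ... | tri< x<y _ _ = let z , 0<z , z<x = dense 0<x in z , 0<z , z<x , <-trans z<x x<y
  ... | tri≈ _ x≈y _ = let z , 0<z , z<x = dense 0<x in z , 0<z , z<x , <-respʳ-≈ x≈y z<x
  ... | tri> _ _ y<x = let z , 0<z , z<y = dense 0<y in z , 0<z , <-trans z<y y<x , z<y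

  -- Finite sums.

  open SemiringSum semiring public
    using (sum-cong-≋; ∑-distrib-+; ∑-comm; *-distribˡ-sum; *-distribʳ-sum
          ; sum-replicate; sum-replicate-zero)

  sum-mono-≤ : ∀ {n} {f g : Vector Carrier n} → (∀ i → f i ≤ g i) → sum f ≤ sum g
  sum-mono-≤ {zero}  f≤g = ≤-refl
  sum-mono-≤ {suc n} f≤g = +-mono-≤ (f≤g zero) (sum-mono-≤ λ i → f≤g (suc i))

  sum-zero : ∀ {n} {f : Vector Carrier n} → (∀ i → f i ≈ 0#) → sum f ≈ 0#
  sum-zero {n} f≈0 = trans (sum-cong-≋ f≈0) (sum-replicate-zero n)

  sum-nonneg : ∀ {n} {f : Vector Carrier n} → (∀ i → 0# ≤ f i) → 0# ≤ sum f
  sum-nonneg {n} 0≤f = ≤-respˡ (sum-replicate-zero n) (sum-mono-≤ 0≤f)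

  sum-nonneg-zero : ∀ {n} {f : Vector Carrier n} → (∀ i → 0# ≤ f i) →
                    sum f ≈ 0# → ∀ i → f i ≈ 0#
  sum-nonneg-zero {suc n} {f} 0≤f ∑f≈0 i = case i
    where
    head≤0 : f zero ≤ 0#
    head≤0 = ≤-respʳ ∑f≈0 (x≤x+d (sum-nonneg λ i → 0≤f (suc i)) refl)
    tail≤0 : sum (λ i → f (suc i)) ≤ 0#
    tail≤0 = ≤-respʳ ∑f≈0 (x≤x+d (0≤f zero) (+-comm _ _))
    case : ∀ i → f i ≈ 0#
    case zero    = ≤-antisym head≤0 (0≤f zero)
    case (suc i) = sum-nonneg-zero (λ i → 0≤f (suc i))
      (≤-antisym tail≤0 (sum-nonneg λ i → 0≤f (suc i))) i

  sum-pick : ∀ {n} (f : Vector Carrier n) i →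
             sum (λ j → if does (i Fin.≟ j) then f j else 0#) ≈ f i
  sum-pick {suc n} f zero    = trans (+-congˡ (sum-replicate-zero n)) (+-identityʳ _)
  sum-pick {suc n} f (suc i) = trans (+-identityˡ _) (sum-pick (λ j → f (suc j)) i)

-- Inner products, quadratic forms and semidefiniteness.

module QuadraticForms (ℝ : CompleteOrderedField) where
  open Reals ℝ
  open OrderedField ℝ

  -- Binds tighter than `_*_`: `c * x · y` is c times the inner product of x and y.
  infix 8 _·_
  _·_ : ∀ {n} → Vector Carrier n → Vector Carrier n → Carrier
  x · y = sum λ i → x i * y i

  quadraticForm : ∀ {n} → Matrix n → Vector Carrier n → Carrier
  quadraticForm M x = x · (λ i → M i · x)

  Symmetric : ∀ {n} → Matrix n → Set
  Symmetric M = ∀ i j → M i j ≈ M j i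

  PositiveSemidefinite : ∀ {n} → Matrix n → Set
  PositiveSemidefinite M = ∀ x → 0# ≤ quadraticForm M x

  NontrivialKernel : ∀ {n} → Matrix n → Set
  NontrivialKernel {n} M = Σ (Vector Carrier n) λ x →
    ¬ (∀ i → x i ≈ 0#) × (∀ i → M i · x ≈ 0#)

  -- Positive definite with the uniform bound c/C on the unit sphere.
  Coercive : ∀ {n} → Matrix n → Set
  Coercive M = ∃ λ c → ∃ λ C → 0# < c × 0# < C ×
    (∀ x → c * (x · x) ≤ C * quadraticForm M x)

  x·x-nonneg : ∀ {n} (x : Vector Carrier n) → 0# ≤ x · x
  x·x-nonneg x = sum-nonneg λ i → square-nonneg (x i)

  ·-congˡ : ∀ {n} {x y z : Vector Carrier n} → (∀ i → y i ≈ z i) → x · y ≈ x · z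
  ·-congˡ y≈z = sum-cong-≋ λ i → *-congˡ (y≈z i)

  ·-scaleˡ : ∀ {n} c (x y : Vector Carrier n) → (λ i → c * x i) · y ≈ c * x · y
  ·-scaleˡ c x y = trans (sum-cong-≋ λ i → *-assoc c (x i) (y i))
                         (sym (*-distribˡ-sum c (λ i → x i * y i)))

  ·-scaleʳ : ∀ {n} c (x y : Vector Carrier n) → x · (λ i → c * y i) ≈ c * x · y
  ·-scaleʳ c x y = trans
    (sum-cong-≋ λ i → solve 3 (λ c x y → x :* (c :* y) := c :* (x :* y)) refl c (x i) (y i))
    (sym (*-distribˡ-sum c (λ i → x i * y i)))

  ·-+ˡ : ∀ {n} (x y z : Vector Carrier n) → (λ i → x i + y i) · z ≈ x · z + y · z
  ·-+ˡ x y z = trans (sum-cong-≋ λ i → distribʳ (z i) (x i) (y i))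
    (∑-distrib-+ (λ i → x i * z i) (λ i → y i * z i))

  ·-+ʳ : ∀ {n} (x y z : Vector Carrier n) → x · (λ i → y i + z i) ≈ x · y + x · z
  ·-+ʳ x y z = trans (sum-cong-≋ λ i → distribˡ (x i) (y i) (z i))
    (∑-distrib-+ (λ i → x i * y i) (λ i → x i * z i))

  -- A Cauchy-Schwarz bound with some constant L, by induction on the dimension from (u + v)² ≤ 2 u²
  -- + 2 v².
  linear-form-bound : ∀ {n} (b : Vector Carrier n) →
    ∃ λ L → 0# ≤ L × (∀ y → (b · y) * (b · y) ≤ L * y · y)
  linear-form-bound {zero}  b = 0# , ≤-refl , λ y → inj₂ refl
  linear-form-bound {suc n} b with linear-form-bound (λ i → b (suc i))
  ... | L , 0≤L , bound = 2# * (b₀ * b₀ + L)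
      , *-nonneg (inj₁ 0<2) (+-nonneg (square-nonneg b₀) 0≤L)
      , λ y → let
          y₀ = y zero
          Y  = (λ i → y (suc i)) · (λ i → y (suc i))
          β  = (λ i → b (suc i)) · (λ i → y (suc i))
          0≤Y = x·x-nonneg (λ i → y (suc i))
        in x≤x+d
          (+-nonneg (+-nonneg (square-nonneg (b₀ * y₀ - β))
            (*-nonneg (inj₁ 0<2) (+-nonneg (*-nonneg (square-nonneg b₀) 0≤Y)
                                           (*-nonneg 0≤L (square-nonneg y₀)))))
            (*-nonneg (inj₁ 0<2) (x≤y⇒0≤y-x (bound λ i → y (suc i)))))
          (solve 5 (λ b₀ y₀ Y β L →
            (:1 :+ :1) :* (b₀ :* b₀ :+ L) :* (y₀ :* y₀ :+ Y) :=
            (b₀ :* y₀ :+ β) :* (b₀ :* y₀ :+ β) :+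
            (((b₀ :* y₀ :- β) :* (b₀ :* y₀ :- β) :+
             (:1 :+ :1) :* (b₀ :* b₀ :* Y :+ L :* (y₀ :* y₀))) :+
             (:1 :+ :1) :* (L :* Y :- β :* β))) refl b₀ y₀ Y β L)
    where b₀ = b zero

  -- Elimination of the first variable.

  module SchurComplement {n} (M : Matrix (suc n)) (M-sym : Symmetric M) where
    p : Carrier
    p = M zero zero

    b : Vector Carrier n
    b i = M zero (suc i)

    M′ : Matrix n
    M′ i j = M (suc i) (suc j)

    -- The Schur complement of p, scaled by p so that no division occurs.
    S : Matrix n
    S i j = p * M′ i j + - b i * b j

    S-sym : Symmetric S
    S-sym i j = +-cong (*-congˡ (M-sym (suc i) (suc j)))
      (solve 2 (λ x y → :- x :* y := :- y :* x) refl (b i) (b j))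

    row-S : ∀ y i → S i · y ≈ p * M′ i · y + - b i * b · y
    row-S y i = trans (·-+ˡ _ _ y) (+-cong (·-scaleˡ p (M′ i) y) (·-scaleˡ (- b i) b y))

    row-M : ∀ x₀ y i → M (suc i) · (x₀ ∷ y) ≈ x₀ * b i + M′ i · y
    row-M x₀ y i = +-congʳ (trans (*-comm _ _) (*-congˡ (M-sym (suc i) zero)))

    form-M : ∀ x₀ y → quadraticForm M (x₀ ∷ y) ≈
             p * (x₀ * x₀) + 2# * x₀ * b · y + quadraticForm M′ y
    form-M x₀ y = begin
      x₀ * (p * x₀ + b · y) + y · (λ i → M (suc i) · (x₀ ∷ y))
        ≈⟨ +-congˡ (·-congˡ {x = y} (row-M x₀ y)) ⟩
      x₀ * (p * x₀ + b · y) + y · (λ i → x₀ * b i + M′ i · y)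
        ≈⟨ +-congˡ (·-+ʳ y _ _) ⟩
      x₀ * (p * x₀ + b · y) + (y · (λ i → x₀ * b i) + quadraticForm M′ y)
        ≈⟨ +-congˡ (+-congʳ (trans (·-scaleʳ x₀ y b) (*-congˡ (sum-cong-≋ λ i → *-comm (y i) (b i))))) ⟩
      x₀ * (p * x₀ + b · y) + (x₀ * b · y + quadraticForm M′ y)
        ≈⟨ solve 4 (λ x₀ p β q → x₀ :* (p :* x₀ :+ β) :+ (x₀ :* β :+ q) :=
             p :* (x₀ :* x₀) :+ (:1 :+ :1) :* x₀ :* β :+ q) refl x₀ p (b · y) _ ⟩
      p * (x₀ * x₀) + 2# * x₀ * b · y + quadraticForm M′ y ∎
      where open SetoidReasoning setoid

    form-S : ∀ y → quadraticForm S y ≈ p * quadraticForm M′ y - (b · y) * (b · y)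
    form-S y = begin
      y · (λ i → S i · y)
        ≈⟨ ·-congˡ {x = y} (row-S y) ⟩
      y · (λ i → p * M′ i · y + - b i * b · y)
        ≈⟨ ·-+ʳ y _ _ ⟩
      y · (λ i → p * M′ i · y) + y · (λ i → - b i * b · y)
        ≈⟨ +-cong (·-scaleʳ p y _) (sum-cong-≋ λ i →
             solve 3 (λ y b β → y :* (:- b :* β) := :- β :* (b :* y)) refl (y i) (b i) (b · y)) ⟩
      p * quadraticForm M′ y + sum (λ i → - (b · y) * (b i * y i))
        ≈⟨ +-congˡ (sym (*-distribˡ-sum (- (b · y)) (λ i → b i * y i))) ⟩
      p * quadraticForm M′ y + - (b · y) * b · y
        ≈⟨ solve 2 (λ q β → q :+ :- β :* β := q :- β :* β) refl _ _ ⟩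
      p * quadraticForm M′ y - (b · y) * (b · y) ∎
      where open SetoidReasoning setoid

    -- The square is completed in the first coordinate after multiplication by p, which avoids
    -- division. This carries a lower bound for the form of `S` over to that of `M`.
    complete-square : ∀ x₀ y → p * quadraticForm M (x₀ ∷ y) ≈
      (p * x₀ + b · y) * (p * x₀ + b · y) + quadraticForm S y
    complete-square x₀ y = trans (*-congˡ (form-M x₀ y)) (trans
      (solve 4 (λ p x₀ β q →
        p :* (p :* (x₀ :* x₀) :+ (:1 :+ :1) :* x₀ :* β :+ q) :=
        (p :* x₀ :+ β) :* (p :* x₀ :+ β) :+ (p :* q :- β :* β)) refl p x₀ (b · y) _)
      (+-congˡ (sym (form-S y))))

    module _ (M-psd : PositiveSemidefinite M) where

      0≤p : 0# ≤ p
      0≤p = ≤-respʳ (trans (form-M 1# (λ _ → 0#)) (begin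
        p * (1# * 1#) + 2# * 1# * (b · λ _ → 0#) + quadraticForm M′ (λ _ → 0#)
          ≈⟨ +-cong (+-congˡ (*-congˡ (sum-zero λ i → zeroʳ (b i))))
                    (sum-zero λ i → zeroˡ (M′ i · λ _ → 0#)) ⟩
        p * (1# * 1#) + 2# * 1# * 0# + 0#
          ≈⟨ solve 1 (λ p → p :* (:1 :* :1) :+ (:1 :+ :1) :* :1 :* :0 :+ :0 := p) refl p ⟩
        p ∎)) (M-psd (1# ∷ λ _ → 0#))
        where open SetoidReasoning setoid

      -- If p = 0 then x₀ ↦ q(x₀, b) is affine with slope 2 b · b.
      p≈0⇒b≈0 : p ≈ 0# → ∀ i → b i ≈ 0#
      p≈0⇒b≈0 p≈0 i with b · b ≟ 0#
      ... | yes b·b≈0 = b-zero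
        where
        b-zero : b i ≈ 0#
        b-zero with b i ≟ 0#
        ... | yes bᵢ≈0 = bᵢ≈0
        ... | no  bᵢ≉0 = ⊥-elim (0<⇒≉0 (square-pos bᵢ≉0)
                (sum-nonneg-zero (λ j → square-nonneg (b j)) b·b≈0 i))
      ... | no  b·b≉0 = ⊥-elim (<⇒≱ negative (M-psd (x₀ ∷ b)))
        where
        w q x₀ : Carrier
        w  = 2# * b · b
        q  = quadraticForm M′ b
        -- The solution of `w * x₀ + q ≈ - 1#`, where the affine function is negative.
        x₀ = (- q - 1#) / w
        0<w : 0# < w
        0<w with x·x-nonneg b
        ... | inj₁ 0<b·b = *-pos 0<2 0<b·b
        ... | inj₂ 0≈b·b = ⊥-elim (b·b≉0 (sym 0≈b·b))
        value : quadraticForm M (x₀ ∷ b) ≈ - 1#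
        value = begin
          quadraticForm M (x₀ ∷ b)                     ≈⟨ form-M x₀ b ⟩
          p * (x₀ * x₀) + 2# * x₀ * b · b + q          ≈⟨ +-congʳ (+-cong
            (trans (*-congʳ p≈0) (zeroˡ _))
            (solve 2 (λ x₀ B → (:1 :+ :1) :* x₀ :* B := ((:1 :+ :1) :* B) :* x₀) refl x₀ (b · b))) ⟩
          0# + w * x₀ + q                              ≈⟨ +-congʳ (trans (+-identityˡ _) (x*y/y≈x _ 0<w)) ⟩
          (- q - 1#) + q                               ≈⟨ solve 1 (λ q → (:- q :- :1) :+ q := :- :1) refl q ⟩
          - 1#                                         ∎
          where open SetoidReasoning setoid
        negative : quadraticForm M (x₀ ∷ b) < 0#
        negative = x<x+d 0<1 (trans (sym (-‿inverseˡ 1#)) (+-congʳ (sym value)))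

      -- When p = 0 the whole first column vanishes, so the first unit vector lies in the kernel.
      kernel₀ : p ≈ 0# → NontrivialKernel M
      kernel₀ p≈0 = 1# ∷ (λ _ → 0#) , (λ x≈0 → 0<⇒≉0 0<1 (x≈0 zero)) , rows
        where
        0· : ∀ (y : Vector Carrier n) → y · (λ _ → 0#) ≈ 0#
        0· y = sum-zero λ i → zeroʳ (y i)
        vanish : ∀ {x} y → x ≈ 0# → x * 1# + y · (λ _ → 0#) ≈ 0#
        vanish y x≈0 = trans (+-cong (trans (*-congʳ x≈0) (zeroˡ 1#)) (0· y)) (+-identityˡ 0#)
        rows : ∀ i → M i · (1# ∷ λ _ → 0#) ≈ 0#
        rows zero    = vanish b p≈0
        rows (suc i) = vanish (M′ i) (trans (M-sym (suc i) zero) (p≈0⇒b≈0 p≈0 i))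

      module _ (0<p : 0# < p) where

        -- The first coordinate is the one at which the square of `complete-square` vanishes once
        -- the others are p y: p (- b · y) + b · (p y) = 0.
        lift : Vector Carrier n → Vector Carrier (suc n)
        lift y = - (b · y) ∷ λ i → p * y i

        form-lift : ∀ y → quadraticForm M (lift y) ≈ p * quadraticForm S y
        form-lift y = begin
          quadraticForm M (lift y)
            ≈⟨ form-M _ _ ⟩
          p * (- β * - β) + 2# * - β * b · py + quadraticForm M′ py
            ≈⟨ +-cong (+-congˡ (*-congˡ (·-scaleʳ p b y))) scaled ⟩
          p * (- β * - β) + 2# * - β * (p * β) + p * (p * q)
            ≈⟨ solve 3 (λ p β q → p :* (:- β :* :- β) :+ (:1 :+ :1) :* :- β :* (p :* β) :+ p :* (p :* q)
                 := p :* (p :* q :- β :* β)) refl p β q ⟩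
          p * (p * q - β * β)
            ≈⟨ *-congˡ (sym (form-S y)) ⟩
          p * quadraticForm S y ∎
          where
          open SetoidReasoning setoid
          β q : Carrier
          β = b · y
          q = quadraticForm M′ y
          py : Vector Carrier n
          py i = p * y i
          scaled : quadraticForm M′ py ≈ p * (p * q)
          scaled = trans (·-scaleˡ p y _) (*-congˡ
            (trans (·-congˡ {x = y} λ i → ·-scaleʳ p (M′ i) y) (·-scaleʳ p y _)))

        S-psd : PositiveSemidefinite S
        S-psd y = *-cancelˡ-≤ 0<p
          (≤-respˡ (sym (zeroʳ p)) (≤-respʳ (form-lift y) (M-psd (lift y))))

        -- The first row vanishes by the choice of the first coordinate of `lift y`; the remaining
        -- rows reproduce those of `S` at y.
        kernel-lift : NontrivialKernel S → NontrivialKernel M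
        kernel-lift (y , y≉0 , Sy≈0) = lift y , lift≉0 , rows
          where
          lift≉0 : ¬ (∀ i → lift y i ≈ 0#)
          lift≉0 lift≈0 = y≉0 λ i → begin
            y i              ≈⟨ x*y/y≈x (y i) 0<p ⟨
            p * (y i * p ⁻¹) ≈⟨ *-assoc p (y i) _ ⟨
            p * y i * p ⁻¹   ≈⟨ *-congʳ (lift≈0 (suc i)) ⟩
            0# * p ⁻¹        ≈⟨ zeroˡ _ ⟩
            0#               ∎
            where open SetoidReasoning setoid
          rows : ∀ i → M i · lift y ≈ 0#
          rows zero    = trans (+-congˡ (·-scaleʳ p b y))
            (solve 2 (λ p β → p :* :- β :+ p :* β := :0) refl p (b · y))
          rows (suc i) = trans (row-M _ _ i) (trans (+-congˡ (·-scaleʳ p (M′ i) y))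
            (trans (solve 3 (λ β b r → :- β :* b :+ r := r :+ :- b :* β) refl (b · y) (b i) _)
              (trans (sym (row-S y i)) (Sy≈0 i))))

        -- Put U = (p x₀ + b · y)², so that p times the form of `M` is U plus the form of `S`. From
        -- p x₀ = (p x₀ + b · y) - b · y one gets (p x₀)² ≤ 2 U + 2 (b · y)², and (b · y)² ≤ L (y ·
        -- y); hence U and y · y control all coordinates (`step₁`). Coercivity of `S` controls y ·
        -- y.
        coercive-lift : Coercive S → Coercive M
        coercive-lift (c , C , 0<c , 0<C , S-bound) =
            p * p * (c * C) , K * (C * p)
          , *-pos (*-pos 0<p 0<p) (*-pos 0<c 0<C) , *-pos 0<K (*-pos 0<C 0<p)
          , λ x → bound (x zero) (λ i → x (suc i))
          where
          L = proj₁ (linear-form-bound b)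
          0≤L = proj₁ (proj₂ (linear-form-bound b))
          K₁ K : Carrier
          K₁ = 2# * L + p * p
          -- Chosen so that the product `K * (C * U + c * Y)` contains both terms of
          -- `c * C * (2# * U + K₁ * Y)`; its other two terms are nonnegative.
          K  = 2# * c + K₁ * C
          0≤K₁ : 0# ≤ K₁
          0≤K₁ = +-nonneg (*-nonneg (inj₁ 0<2) 0≤L) (square-nonneg p)
          0<K : 0# < K
          0<K = +-pos (*-pos 0<2 0<c) (*-nonneg 0≤K₁ (inj₁ 0<C))
          bound : ∀ x₀ y → p * p * (c * C) * (x₀ * x₀ + y · y) ≤
                           K * (C * p) * quadraticForm M (x₀ ∷ y)
          bound x₀ y = begin
            p * p * (c * C) * (x₀ * x₀ + Y)
              ≈⟨ solve 5 (λ p c C x₀ Y → p :* p :* (c :* C) :* (x₀ :* x₀ :+ Y)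
                   := c :* C :* (p :* x₀ :* (p :* x₀) :+ p :* p :* Y)) refl p c C x₀ Y ⟩
            c * C * (p * x₀ * (p * x₀) + p * p * Y)
              ≤⟨ *-monoʳ-≤ (inj₁ (*-pos 0<c 0<C)) step₁ ⟩
            c * C * (2# * U + K₁ * Y)
              ≤⟨ x≤x+d (+-nonneg (*-nonneg (inj₁ 0<2) (*-nonneg (square-nonneg c) 0≤Y))
                                 (*-nonneg 0≤K₁ (*-nonneg (square-nonneg C) 0≤U)))
                   (solve 5 (λ c C U K₁ Y →
                     ((:1 :+ :1) :* c :+ K₁ :* C) :* (C :* U :+ c :* Y) :=
                     c :* C :* ((:1 :+ :1) :* U :+ K₁ :* Y) :+
                     ((:1 :+ :1) :* (c :* c :* Y) :+ K₁ :* (C :* C :* U))) refl c C U K₁ Y) ⟩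
            K * (C * U + c * Y)
              ≤⟨ *-monoʳ-≤ (inj₁ 0<K) (+-mono-≤ ≤-refl (S-bound y)) ⟩
            K * (C * U + C * quadraticForm S y)
              ≈⟨ *-congˡ (trans (sym (distribˡ C U _)) (*-congˡ (sym (complete-square x₀ y)))) ⟩
            K * (C * (p * quadraticForm M (x₀ ∷ y)))
              ≈⟨ trans (*-congˡ (sym (*-assoc C p _))) (sym (*-assoc K _ _)) ⟩
            K * (C * p) * quadraticForm M (x₀ ∷ y) ∎
            where
            open ≤-Reasoning
            Y β U : Carrier
            Y = y · y
            β = b · y
            U = (p * x₀ + β) * (p * x₀ + β)
            0≤Y = x·x-nonneg y
            0≤U = square-nonneg (p * x₀ + β)
            step₁ : p * x₀ * (p * x₀) + p * p * Y ≤ 2# * U + K₁ * Y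
            step₁ = x≤x+d
              (+-nonneg (square-nonneg (p * x₀ + 2# * β))
                (*-nonneg (inj₁ 0<2) (x≤y⇒0≤y-x (proj₂ (proj₂ (linear-form-bound b)) y))))
              (solve 5 (λ p x₀ β L Y →
                (:1 :+ :1) :* ((p :* x₀ :+ β) :* (p :* x₀ :+ β)) :+ ((:1 :+ :1) :* L :+ p :* p) :* Y :=
                (p :* x₀ :* (p :* x₀) :+ p :* p :* Y) :+
                ((p :* x₀ :+ (:1 :+ :1) :* β) :* (p :* x₀ :+ (:1 :+ :1) :* β) :+
                 (:1 :+ :1) :* (L :* Y :- β :* β))) refl p x₀ β L Y)

  -- Stands in for compactness of the unit sphere. A zero pivot yields a kernel vector; a positive
  -- pivot passes either alternative up from the Schur complement.
  semidefinite-alternative : ∀ {n} (M : Matrix n) → Symmetric M → PositiveSemidefinite M →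
                             NontrivialKernel M ⊎ Coercive M
  semidefinite-alternative {zero}  M M-sym M-psd =
    inj₂ (1# , 1# , 0<1 , 0<1 , λ x → inj₂ refl)
  semidefinite-alternative {suc n} M M-sym M-psd = case (0≤p M-psd)
    where
    open SchurComplement M M-sym
    case : 0# ≤ p → NontrivialKernel M ⊎ Coercive M
    case (inj₂ 0≈p) = inj₁ (kernel₀ M-psd (sym 0≈p))
    case (inj₁ 0<p) with semidefinite-alternative S S-sym (S-psd M-psd 0<p)
    ... | inj₁ ker = inj₁ (kernel-lift M-psd 0<p ker)
    ... | inj₂ coe = inj₂ (coercive-lift M-psd 0<p coe)

-- The Rayleigh bound for the largest eigenvalue.

module Rayleigh (ℝ : CompleteOrderedField) where
  open Reals ℝ
  open OrderedField ℝ
  open QuadraticForms ℝ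

  if-* : ∀ b c y → (if b then c else 0#) * y ≈ (if b then c * y else 0#)
  if-* true  c y = refl
  if-* false c y = zeroˡ y

  ≟-sym : ∀ {n} (i j : Fin n) → does (i Fin.≟ j) ≡ does (j Fin.≟ i)
  ≟-sym i j with i Fin.≟ j | j Fin.≟ i
  ... | yes _   | yes _   = ≡.refl
  ... | no  _   | no  _   = ≡.refl
  ... | yes i≡j | no  j≢i = ⊥-elim (j≢i (≡.sym i≡j))
  ... | no  i≢j | yes j≡i = ⊥-elim (i≢j (≡.sym j≡i))

  diagonal-· : ∀ {n} (d : Vector Carrier n) x i →
               (λ j → if does (i Fin.≟ j) then d i else 0#) · x ≈ d i * x i
  diagonal-· d x i = trans (sum-cong-≋ λ j → if-* (does (i Fin.≟ j)) (d i) (x j))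
                           (sum-pick (λ j → d i * x j) i)

  ·-bound : ∀ {n} (x z : Vector Carrier n) → x · z ≤ x · x + z · z
  ·-bound x z = ≤-respʳ (∑-distrib-+ (λ i → x i * x i) (λ i → z i * z i))
    (sum-mono-≤ λ i → *-cancelˡ-≤ 0<2 (x≤x+d
      (+-nonneg (square-nonneg (x i - z i)) (+-nonneg (square-nonneg (x i)) (square-nonneg (z i))))
      (solve 2 (λ x z → (:1 :+ :1) :* (x :* x :+ z :* z) :=
        (:1 :+ :1) :* (x :* z) :+ ((x :- z) :* (x :- z) :+ (x :* x :+ z :* z)))
        refl (x i) (z i))))

  -- Gives the upper bound that the supremum in `rayleigh` requires. Each coordinate of Mx is a
  -- linear form, so its square is bounded by a multiple of x · x.
  quadraticForm-bound : ∀ {n} (M : Matrix n) →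
                        ∃ λ B → ∀ x → quadraticForm M x ≤ B * x · x
  quadraticForm-bound {n} M = 1# + sum L , λ x → begin
    quadraticForm M x                            ≤⟨ ·-bound x (λ i → M i · x) ⟩
    x · x + (λ i → M i · x) · (λ i → M i · x)    ≤⟨ +-mono-≤ ≤-refl (sum-mono-≤ λ i →
                                                      proj₂ (proj₂ (linear-form-bound (M i))) x) ⟩
    x · x + sum (λ i → L i * x · x)              ≈⟨ +-cong (sym (*-identityˡ _))
                                                      (sym (*-distribʳ-sum (x · x) L)) ⟩
    1# * x · x + sum L * x · x                   ≈⟨ distribʳ (x · x) 1# (sum L) ⟨
    (1# + sum L) * x · x                         ∎
    where
    open ≤-Reasoning
    L : Vector Carrier n
    L i = proj₁ (linear-form-bound (M i))

  module _ {n} (M : Matrix n) (M-sym : Symmetric M) where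

    -- Says that y lies below some Rayleigh quotient. In this division-free form the strict
    -- inequality itself forces x to be nonzero.
    ExceededBy : Carrier → Set
    ExceededBy y = ∃ λ x → y * x · x < quadraticForm M x

    -- A number strictly between y and the quotient of x still qualifies. Hence the set has no
    -- maximum, and its members lie strictly below its supremum.
    exceeded-open : ∀ {y} → ExceededBy y → ∃ λ z → y < z × ExceededBy z
    exceeded-open {y} (x , yX<q) = z , y<z
      , x , <-respˡ-≈ (*-comm _ _) (<-respʳ-≈ (x*y/y≈x _ 0<X) (*-monoʳ-< 0<X z<q/X))
      where
      0<X : 0# < x · x
      0<X with x·x-nonneg x
      ... | inj₁ 0<X = 0<X
      ... | inj₂ 0≈X = ⊥-elim (irrefl
              (trans (trans (*-congˡ (sym 0≈X)) (zeroʳ y)) (sym q≈0)) yX<q)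
        where
        x≈0 : ∀ i → x i ≈ 0#
        x≈0 i with x i ≟ 0#
        ... | yes xᵢ≈0 = xᵢ≈0
        ... | no  xᵢ≉0 = ⊥-elim (0<⇒≉0 (square-pos xᵢ≉0)
                (sum-nonneg-zero (λ j → square-nonneg (x j)) (sym 0≈X) i))
        q≈0 : quadraticForm M x ≈ 0#
        q≈0 = sum-zero λ i → trans (*-congʳ (x≈0 i)) (zeroˡ (M i · x))
      y<q/X : y < quadraticForm M x / x · x
      y<q/X = *-cancelˡ-< 0<X (<-respʳ-≈ (sym (x*y/y≈x _ 0<X)) (<-respˡ-≈ (*-comm _ _) yX<q))
      z = proj₁ (dense y<q/X)
      y<z = proj₁ (proj₂ (dense y<q/X))
      z<q/X = proj₂ (proj₂ (dense y<q/X))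

    not-exceeded : ∀ {b y} → (∀ x → quadraticForm M x ≤ b * x · x) → ExceededBy y → y ≤ b
    not-exceeded q≤bX (x , yX<q) = ≮⇒≥ λ b<y →
      <⇒≱ yX<q (≤-trans (q≤bX x) (*-monoˡ-≤ (x·x-nonneg x) (inj₁ b<y)))

    module Shift (s : Carrier) where

      -- The factor `- 1#` makes the scaling lemmas for `_·_` applicable.
      sI-M : Matrix n
      sI-M i j = (if does (i Fin.≟ j) then s else 0#) + - 1# * M i j

      sI-M-sym : Symmetric sI-M
      sI-M-sym i j = +-cong (reflexive (≡.cong (if_then s else 0#) (≟-sym i j)))
                            (*-congˡ (M-sym i j))

      sI-M-row : ∀ x i → sI-M i · x ≈ s * x i + - 1# * M i · x
      sI-M-row x i = trans (·-+ˡ _ _ x)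
        (+-cong (diagonal-· (λ _ → s) x i) (·-scaleˡ (- 1#) (M i) x))

      sI-M-form : ∀ x → quadraticForm sI-M x ≈ s * x · x - quadraticForm M x
      sI-M-form x = begin
        x · (λ i → sI-M i · x)
          ≈⟨ ·-congˡ {x = x} (sI-M-row x) ⟩
        x · (λ i → s * x i + - 1# * M i · x)
          ≈⟨ ·-+ʳ x _ _ ⟩
        x · (λ i → s * x i) + x · (λ i → - 1# * M i · x)
          ≈⟨ +-cong (·-scaleʳ s x x) (·-scaleʳ (- 1#) x _) ⟩
        s * x · x + - 1# * quadraticForm M x
          ≈⟨ solve 2 (λ u q → u :+ :- :1 :* q := u :- q) refl _ _ ⟩
        s * x · x - quadraticForm M x ∎
        where open SetoidReasoning setoid

      kernel⇒eigenvalue : NontrivialKernel sI-M → IsEigenvalue M s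
      kernel⇒eigenvalue (x , x≉0 , rows) = x , x≉0 , λ i → begin
        M i · x
          ≈⟨ solve 2 (λ u m → m := u :- (u :+ :- :1 :* m)) refl (s * x i) (M i · x) ⟩
        s * x i - (s * x i + - 1# * M i · x)
          ≈⟨ +-congˡ (-‿cong (trans (sym (sI-M-row x i)) (rows i))) ⟩
        s * x i - 0#
          ≈⟨ solve 1 (λ u → u :- :0 := u) refl (s * x i) ⟩
        s * x i ∎
        where open SetoidReasoning setoid

      -- Coercivity leaves a gap below s: C (s (x · x) - q) ≥ c (x · x) means q ≤ (s - c/C) (x · x).
      coercive⇒not-least : Coercive sI-M →
        ∃ λ b → b < s × (∀ x → quadraticForm M x ≤ b * x · x)
      coercive⇒not-least (c , C , 0<c , 0<C , bound) = s - c / C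
        , x<x+d (/-pos 0<c 0<C) (solve 2 (λ s d → s := (s :- d) :+ d) refl s (c / C))
        , λ x → *-cancelˡ-≤ 0<C (x≤x+d
            (x≤y⇒0≤y-x (≤-respʳ (*-congˡ (sI-M-form x))
              (≤-respˡ (*-congʳ (sym (x*y/y≈x c 0<C))) (bound x))))
            (solve 5 (λ C s d X q → C :* ((s :- d) :* X) :=
               C :* q :+ (C :* (s :* X :- q) :- C :* d :* X))
               refl C s (c / C) (x · x) (quadraticForm M x)))

    -- If some quotient exceeded λ₁, the supremum s of the numbers below quotients would be greater
    -- than λ₁. A kernel vector of sI - M would make s an eigenvalue beyond the largest one, and
    -- coercivity would give an upper bound smaller than s.
    rayleigh : ∀ {λ₁} → IsLargestEigenvalue M λ₁ → ∀ x → quadraticForm M x ≤ λ₁ * x · x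
    rayleigh {λ₁} (_ , λ₁-largest) x = ≮⇒≥ λ λ₁X<q → absurd (x , λ₁X<q)
      where
      absurd : ¬ ExceededBy λ₁
      absurd λ₁-exceeded = case (semidefinite-alternative sI-M sI-M-sym psd)
        where
        B = proj₁ (quadraticForm-bound M)
        sup = supremum ExceededBy (λ₁ , λ₁-exceeded)
          (B , λ y → not-exceeded (proj₂ (quadraticForm-bound M)))
        s = proj₁ sup
        s-upper = proj₁ (proj₂ sup)
        s-least = proj₂ (proj₂ sup)
        open Shift s
        below-sup : ∀ {y} → ExceededBy y → y < s
        below-sup ex = let z , y<z , z-ex = exceeded-open ex in <-≤-trans y<z (s-upper z z-ex)
        -- A vector of negative value would put s into the set whose members are strictly below s.
        psd : PositiveSemidefinite sI-M
        psd y = ≤-respʳ (sym (sI-M-form y)) (x≤y⇒0≤y-x (≮⇒≥ λ sX<q →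
          irrefl refl (below-sup (y , sX<q))))
        case : NontrivialKernel sI-M ⊎ Coercive sI-M → ⊥
        case (inj₁ ker) = <⇒≱ (below-sup λ₁-exceeded) (λ₁-largest s (kernel⇒eigenvalue ker))
        case (inj₂ coe) = let b , b<s , q≤bX = coercive⇒not-least coe in
          <⇒≱ b<s (s-least b λ y → not-exceeded q≤bX)

-- Fractional matchings of a graph and of its bipartite double cover.

module FractionalMatchings (ℝ : CompleteOrderedField) where
  open Reals ℝ
  open OrderedField ℝ

  𝟙 : Bool → Carrier
  𝟙 b = if b then 1# else 0#

  0≤𝟙 : ∀ b → 0# ≤ 𝟙 b
  0≤𝟙 true  = 0≤1
  0≤𝟙 false = ≤-refl

  𝟙≤1 : ∀ b → 𝟙 b ≤ 1#
  𝟙≤1 true  = ≤-refl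
  𝟙≤1 false = 0≤1

  entry≤sum : ∀ {n} {f : Vector Carrier n} → (∀ i → 0# ≤ f i) → ∀ i → f i ≤ sum f
  entry≤sum {f = f} 0≤f i = ≤-respˡ (sum-pick f i) (sum-mono-≤ term)
    where
    term : ∀ j → (if does (i Fin.≟ j) then f j else 0#) ≤ f j
    term j with does (i Fin.≟ j)
    ... | true  = ≤-refl
    ... | false = 0≤f j

  total : ∀ {n} → Matrix n → Carrier
  total g = sum λ u → sum λ v → g u v

  unit : ∀ {n} → Fin n → Fin n → Carrier → Matrix n
  unit u v ε a b = if does (u Fin.≟ a) then (if does (v Fin.≟ b) then ε else 0#) else 0#

  module _ {n} (u v : Fin n) (ε : Carrier) where

    unit-row : ∀ a → sum (unit u v ε a) ≈ (if does (u Fin.≟ a) then ε else 0#)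
    unit-row a with does (u Fin.≟ a)
    ... | true  = sum-pick (λ _ → ε) v
    ... | false = sum-replicate-zero n

    unit-column : ∀ b → sum (λ a → unit u v ε a b) ≈ (if does (v Fin.≟ b) then ε else 0#)
    unit-column b = sum-pick (λ _ → if does (v Fin.≟ b) then ε else 0#) u

    unit-total : total (unit u v ε) ≈ ε
    unit-total = trans (sum-cong-≋ unit-row) (sum-pick (λ _ → ε) u)

    unit-nonneg : 0# ≤ ε → ∀ a b → 0# ≤ unit u v ε a b
    unit-nonneg 0≤ε a b with does (u Fin.≟ a) | does (v Fin.≟ b)
    ... | true  | true  = 0≤ε
    ... | true  | false = ≤-refl
    ... | false | _     = ≤-refl

    unit-cases : ∀ a b → (u ≡ a × v ≡ b × unit u v ε a b ≡ ε) ⊎ unit u v ε a b ≡ 0#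
    unit-cases a b with u Fin.≟ a | v Fin.≟ b
    ... | yes u≡a | yes v≡b = inj₁ (u≡a , v≡b , ≡.refl)
    ... | yes _   | no  _   = inj₂ ≡.refl
    ... | no  _   | _       = inj₂ ≡.refl

  infixl 6 _⊞_
  _⊞_ : ∀ {n} → Matrix n → Matrix n → Matrix n
  (g ⊞ h) a b = g a b + h a b

  ⊞-total : ∀ {n} (g h : Matrix n) → total (g ⊞ h) ≈ total g + total h
  ⊞-total g h = trans (sum-cong-≋ λ u → ∑-distrib-+ (g u) (h u))
                      (∑-distrib-+ (λ u → sum (g u)) (λ u → sum (h u)))

  module _ {n} (G : SimpleGraph n) where

    -- A fractional matching of the bipartite double cover of G.
    record IsCoverMatching (g : Matrix n) : Set where
      field
        supported : ∀ u v → adj G u v ≡ false → g u v ≈ 0#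
        nonneg    : ∀ u v → 0# ≤ g u v
        row       : ∀ u → sum (λ v → g u v) ≤ 1#
        column    : ∀ v → sum (λ u → g u v) ≤ 1#

    open IsCoverMatching

    matching⇒cover : ∀ {f} → IsFractionalMatching G f → IsCoverMatching f
    matching⇒cover f-fm = record
      { supported = F.supported ; nonneg = F.nonneg ; row = F.vertex
      ; column = λ v → ≤-respˡ (sum-cong-≋ λ u → F.symmetric v u) (F.vertex v) }
      where module F = IsFractionalMatching f-fm

    -- `total` meets every edge as (u, v) and as (v, u), whereas `size` keeps only the pair with u <
    -- v; the diagonal vanishes since there are no loops.
    size-total : ∀ {f} → IsFractionalMatching G f → total f ≈ 2# * size G f
    size-total {f} f-fm = begin
      total f
        ≈⟨ sum-cong-≋ (λ u → sum-cong-≋ λ v → split u v) ⟩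
      total (below ⊞ λ u v → below v u)
        ≈⟨ ⊞-total below (λ u v → below v u) ⟩
      size G f + total (λ u v → below v u)
        ≈⟨ +-congˡ (∑-comm (λ u v → below v u)) ⟩
      size G f + size G f
        ≈⟨ solve 1 (λ s → s :+ s := (:1 :+ :1) :* s) refl (size G f) ⟩
      2# * size G f ∎
      where
      open SetoidReasoning setoid
      module F = IsFractionalMatching f-fm
      below : Matrix n
      below u v = if does (u Fin.<? v) then f u v else 0#
      split : ∀ u v → f u v ≈ below u v + below v u
      split u v = pick (u Fin.<? v) (v Fin.<? u)
        where
        pick : (d : Dec (u Fin.< v)) (e : Dec (v Fin.< u)) → f u v ≈
               (if does d then f u v else 0#) + (if does e then f v u else 0#)
        pick (yes u<v) (yes v<u) = ⊥-elim (Fin.<-asym u<v v<u)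
        pick (yes _)   (no  _)   = sym (+-identityʳ _)
        pick (no  _)   (yes _)   = trans (F.symmetric u v) (sym (+-identityˡ _))
        pick (no  u≮v) (no  v≮u) with Fin.<-cmp u v
        ... | tri< u<v _ _    = ⊥-elim (u≮v u<v)
        ... | tri> _ _ v<u    = ⊥-elim (v≮u v<u)
        ... | tri≈ _ ≡.refl _ = trans (F.supported u u (adj-irrefl G u)) (sym (+-identityˡ 0#))

    module Symmetrization {g} (g-cm : IsCoverMatching g) where

      -- The average of g and its transpose: a fractional matching of G of the same total.
      h : Matrix n
      h u v = (g u v + g v u) / 2#

      2h : ∀ u v → 2# * h u v ≈ g u v + g v u
      2h u v = x*y/y≈x _ 0<2

      h-nonneg : ∀ u v → 0# ≤ h u v
      h-nonneg u v = *-cancelˡ-≤ 0<2 (≤-respˡ (sym (zeroʳ 2#)) (≤-respʳ (sym (2h u v))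
        (+-nonneg (nonneg g-cm u v) (nonneg g-cm v u))))

      h-vertex : ∀ u → sum (h u) ≤ 1#
      h-vertex u = *-cancelˡ-≤ 0<2 (begin
        2# * sum (h u)                               ≈⟨ *-distribˡ-sum 2# (h u) ⟩
        sum (λ v → 2# * h u v)                       ≈⟨ sum-cong-≋ (2h u) ⟩
        sum (λ v → g u v + g v u)                    ≈⟨ ∑-distrib-+ (g u) (λ v → g v u) ⟩
        sum (g u) + sum (λ v → g v u)                ≤⟨ +-mono-≤ (row g-cm u) (column g-cm u) ⟩
        1# + 1#                                      ≈⟨ *-identityʳ 2# ⟨
        2# * 1#                                      ∎)
        where open ≤-Reasoning

      h-matching : IsFractionalMatching G h
      h-matching = record
        { symmetric = λ u v → *-congʳ (+-comm _ _)
        ; supported = λ u v u≁v → trans (*-congʳ (trans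
            (+-cong (supported g-cm u v u≁v) (supported g-cm v u (≡.trans (adj-sym G v u) u≁v)))
            (+-identityˡ 0#))) (zeroˡ _)
        ; nonneg    = h-nonneg
        ; ≤-one     = λ u v → ≤-trans (entry≤sum (h-nonneg u) v) (h-vertex u)
        ; vertex    = h-vertex
        }

      total-h : total h ≈ total g
      total-h = begin
        total h                                ≈⟨ sum-cong-≋ (λ u → sum-cong-≋ λ v → distribʳ _ (g u v) (g v u)) ⟩
        total (half ⊞ λ u v → half v u)        ≈⟨ ⊞-total half (λ u v → half v u) ⟩
        total half + total (λ u v → half v u)  ≈⟨ +-congˡ (∑-comm (λ u v → half v u)) ⟩
        total half + total half                ≈⟨ ⊞-total half half ⟨
        total (half ⊞ half)                    ≈⟨ sum-cong-≋ (λ u → sum-cong-≋ λ v → double u v) ⟩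
        total g                                ∎
        where
        open SetoidReasoning setoid
        half : Matrix n
        half u v = g u v / 2#
        double : ∀ u v → half u v + half u v ≈ g u v
        double u v = trans (solve 1 (λ x → x :+ x := (:1 :+ :1) :* x) refl (half u v))
                           (x*y/y≈x (g u v) 0<2)

    -- Moving weight in a maximum matching of the double cover.

    module Maximal {f} (f-fm : IsFractionalMatching G f)
                   (f-max : ∀ h → IsFractionalMatching G h → size G h ≤ size G f) where

      private module F = IsFractionalMatching f-fm

      -- Symmetrization extends the maximality of f from G to the double cover.
      total-max : ∀ {g} → IsCoverMatching g → total g ≤ total f
      total-max {g} g-cm = begin
        total g          ≈⟨ total-h ⟨
        total h          ≈⟨ size-total h-matching ⟩
        2# * size G h    ≤⟨ *-monoʳ-≤ (inj₁ 0<2) (f-max h h-matching) ⟩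
        2# * size G f    ≈⟨ size-total f-fm ⟨
        total f          ∎
        where
        open ≤-Reasoning
        open Symmetrization g-cm

      -- The maximum cover matchings reachable from f by moving the deficit
      -- between rows.
      record Shifted (g : Matrix n) : Set where
        field
          cover    : IsCoverMatching g
          total≈   : total g ≈ total f
          column≈  : ∀ v → sum (λ u → g u v) ≈ sum (λ u → f u v)
          -- Only part of the weight of an entry is ever moved, so each edge carrying weight in f
          -- can give weight again.
          support⊇ : ∀ u v → 0# < f u v → 0# < g u v

      open Shifted

      -- Takes the place of reachability along alternating paths; quantifying over matchings avoids
      -- handling paths.
      Exposable : Fin n → Set
      Exposable w = ∃ λ g → Shifted g × sum (g w) < 1#

      exposed : ∀ {w} → sum (f w) < 1# → Exposable w
      exposed row<1 = f , record
        { cover = matching⇒cover f-fm ; total≈ = refl ; column≈ = λ _ → refl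
        ; support⊇ = λ _ _ 0<f → 0<f } , row<1

      -- Otherwise the edge wv of the cover could be given more weight.
      neighbour-saturated : ∀ {w v} → Exposable w → adj G w v ≡ true → 1# ≤ sum (λ u → f u v)
      neighbour-saturated {w} {v} (g , g-sh , row<1) w∼v = ≮⇒≥ absurd
        where
        g-cm = cover g-sh
        absurd : ¬ (sum (λ u → f u v) < 1#)
        absurd col<1 = <⇒≱ (x<x+d 0<ε (begin
          total (g ⊞ unit w v ε)          ≈⟨ ⊞-total g (unit w v ε) ⟩
          total g + total (unit w v ε)    ≈⟨ +-cong (total≈ g-sh) (unit-total w v ε) ⟩
          total f + ε                     ∎)) (total-max augmented)
          where
          open SetoidReasoning setoid
          -- ε fits into the slack of row w in g and of column v, which g shares with f.
          gap = smaller-than-both (x<y⇒0<y-x row<1)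
                  (x<y⇒0<y-x (<-respˡ-≈ (sym (column≈ g-sh v)) col<1))
          ε = proj₁ gap
          0<ε = proj₁ (proj₂ gap)
          ε<row = proj₁ (proj₂ (proj₂ gap))
          ε<col = proj₂ (proj₂ (proj₂ gap))
          fill : ∀ {x} → ε < 1# - x → x + ε ≤ 1#
          fill {x} ε<1-x = x≤x+d (x≤y⇒0≤y-x (inj₁ ε<1-x))
            (solve 2 (λ x ε → :1 := (x :+ ε) :+ ((:1 :- x) :- ε)) refl x ε)
          augmented : IsCoverMatching (g ⊞ unit w v ε)
          augmented .supported a b a≁b with unit-cases w v ε a b
          ... | inj₁ (≡.refl , ≡.refl , _) with () ← ≡.trans (≡.sym w∼v) a≁b
          ... | inj₂ eq = trans (+-cong (supported g-cm a b a≁b) (reflexive eq)) (+-identityˡ 0#)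
          augmented .nonneg a b = +-nonneg (nonneg g-cm a b) (unit-nonneg w v ε (inj₁ 0<ε) a b)
          augmented .row a = ≤-respˡ (sym (trans (∑-distrib-+ (g a) (unit w v ε a))
                                                 (+-congˡ (unit-row w v ε a)))) bound
            where
            bound : sum (g a) + (if does (w Fin.≟ a) then ε else 0#) ≤ 1#
            bound with w Fin.≟ a
            ... | yes ≡.refl = fill ε<row
            ... | no  _      = ≤-respˡ (sym (+-identityʳ _)) (row g-cm a)
          augmented .column b = ≤-respˡ (sym (trans
              (∑-distrib-+ (λ a → g a b) (λ a → unit w v ε a b))
              (+-congˡ (unit-column w v ε b)))) bound
            where
            bound : sum (λ a → g a b) + (if does (v Fin.≟ b) then ε else 0#) ≤ 1#
            bound with v Fin.≟ b
            ... | yes ≡.refl = fill ε<col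
            ... | no  _      = ≤-respˡ (sym (+-identityʳ _)) (column g-cm b)

      -- Move a little weight from the edge uv of the cover to the edge wv.
      partner-exposable : ∀ {w v u} → Exposable w → adj G w v ≡ true → 0# < f u v → Exposable u
      partner-exposable {w} {v} {u} w-ex@(g , g-sh , row<1) w∼v 0<fuv with w Fin.≟ u
      ... | yes ≡.refl = w-ex
      ... | no  w≢u    = g′ , shifted , row-u<1
        where
        g-cm = cover g-sh
        u∼v : adj G u v ≡ true
        u∼v with adj G u v in eq
        ... | true  = ≡.refl
        ... | false = ⊥-elim (0<⇒≉0 0<fuv (F.supported u v eq))
        -- The first bound keeps row w feasible; the second leaves the entry uv positive.
        gap = smaller-than-both (x<y⇒0<y-x row<1) (support⊇ g-sh u v 0<fuv)
        ε = proj₁ gap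
        0<ε = proj₁ (proj₂ gap)
        ε<row = proj₁ (proj₂ (proj₂ gap))
        ε<guv = proj₂ (proj₂ (proj₂ gap))
        plus minus g′ : Matrix n
        plus  = unit w v ε
        minus = unit u v (- ε)
        g′ = g ⊞ plus ⊞ minus
        plus-nonneg = unit-nonneg w v ε (inj₁ 0<ε)
        cancel : ∀ x → x + ε + - ε ≈ x
        cancel x = solve 2 (λ x ε → x :+ ε :+ :- ε := x) refl x ε
        cancel-if : ∀ (c : Bool) x → x + (if c then ε else 0#) + (if c then - ε else 0#) ≈ x
        cancel-if true  x = cancel x
        cancel-if false x = trans (+-identityʳ _) (+-identityʳ _)
        row′ : ∀ a → sum (g′ a) ≈
          sum (g a) + (if does (w Fin.≟ a) then ε else 0#) + (if does (u Fin.≟ a) then - ε else 0#)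
        row′ a = trans (∑-distrib-+ (λ b → g a b + plus a b) (minus a)) (+-cong
          (trans (∑-distrib-+ (g a) (plus a)) (+-congˡ (unit-row w v ε a)))
          (unit-row u v (- ε) a))
        -- Both changed entries lie in column v, so their changes cancel there.
        column′ : ∀ b → sum (λ a → g′ a b) ≈ sum (λ a → g a b)
        column′ b = trans (trans
          (∑-distrib-+ (λ a → g a b + plus a b) (λ a → minus a b)) (+-cong
            (trans (∑-distrib-+ (λ a → g a b) (λ a → plus a b)) (+-congˡ (unit-column w v ε b)))
            (unit-column u v (- ε) b)))
          (cancel-if (does (v Fin.≟ b)) _)
        total′ : total g′ ≈ total g
        total′ = trans (trans (⊞-total (g ⊞ plus) minus) (+-cong
          (trans (⊞-total g plus) (+-congˡ (unit-total w v ε))) (unit-total u v (- ε))))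
          (cancel (total g))
        reduced : ∀ {x p} → ε < x → 0# ≤ p → 0# < x + p + - ε
        reduced {x} {p} ε<x 0≤p = <-≤-trans (x<y⇒0<y-x ε<x)
          (x≤x+d 0≤p (solve 3 (λ x p ε → x :+ p :+ :- ε := (x :- ε) :+ p) refl x p ε))
        unchanged : ∀ {x m} → m ≡ 0# → x + m ≈ x
        unchanged ≡.refl = +-identityʳ _
        row-u<1 : sum (g′ u) < 1#
        row-u<1 = <-respˡ-≈ (sym (row′ u)) lower
          where
          lower : sum (g u) + (if does (w Fin.≟ u) then ε else 0#) +
                  (if does (u Fin.≟ u) then - ε else 0#) < 1#
          lower with w Fin.≟ u | u Fin.≟ u
          ... | yes w≡u | _       = ⊥-elim (w≢u w≡u)
          ... | no  _   | no  u≢u = ⊥-elim (u≢u ≡.refl)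
          ... | no  _   | yes _   = <-≤-trans
            (x<x+d 0<ε (solve 2 (λ x ε → x := (x :+ :0 :+ :- ε) :+ ε) refl _ ε))
            (row g-cm u)
        shifted : Shifted g′
        shifted .cover .supported a b a≁b with unit-cases w v ε a b | unit-cases u v (- ε) a b
        ... | inj₁ (≡.refl , ≡.refl , _) | _ with () ← ≡.trans (≡.sym w∼v) a≁b
        ... | inj₂ _ | inj₁ (≡.refl , ≡.refl , _) with () ← ≡.trans (≡.sym u∼v) a≁b
        ... | inj₂ p | inj₂ m = trans (unchanged m) (trans (unchanged p) (supported g-cm a b a≁b))
        shifted .cover .nonneg a b with unit-cases u v (- ε) a b
        ... | inj₁ (≡.refl , ≡.refl , eq) =
          ≤-respʳ (+-congˡ (reflexive (≡.sym eq))) (inj₁ (reduced ε<guv (plus-nonneg a b)))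
        ... | inj₂ eq = ≤-respʳ (sym (unchanged eq)) (+-nonneg (nonneg g-cm a b) (plus-nonneg a b))
        shifted .cover .row a = ≤-respˡ (sym (row′ a)) bound
          where
          bound : sum (g a) + (if does (w Fin.≟ a) then ε else 0#) +
                  (if does (u Fin.≟ a) then - ε else 0#) ≤ 1#
          bound with w Fin.≟ a | u Fin.≟ a
          ... | yes ≡.refl | yes ≡.refl = ⊥-elim (w≢u ≡.refl)
          ... | yes ≡.refl | no  _      = x≤x+d (x≤y⇒0≤y-x (inj₁ ε<row))
            (solve 2 (λ x ε → :1 := (x :+ ε :+ :0) :+ ((:1 :- x) :- ε)) refl _ ε)
          ... | no  _      | yes ≡.refl = ≤-trans (x≤x+d (inj₁ 0<ε)
            (solve 2 (λ x ε → x := (x :+ :0 :+ :- ε) :+ ε) refl _ ε)) (row g-cm a)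
          ... | no  _      | no  _      =
            ≤-respˡ (sym (trans (+-identityʳ _) (+-identityʳ _))) (row g-cm a)
        shifted .cover .column b = ≤-respˡ (sym (column′ b)) (column g-cm b)
        shifted .total≈ = trans total′ (total≈ g-sh)
        shifted .column≈ b = trans (column′ b) (column≈ g-sh b)
        shifted .support⊇ a b 0<fab with unit-cases u v (- ε) a b
        ... | inj₁ (≡.refl , ≡.refl , eq) =
          <-respʳ-≈ (+-congˡ (reflexive (≡.sym eq))) (reduced ε<guv (plus-nonneg a b))
        ... | inj₂ eq = <-respʳ-≈ (sym (unchanged eq))
          (+-pos (support⊇ g-sh a b 0<fab) (plus-nonneg a b))

      module Deficiency (exposable? : ∀ w → Dec (Exposable w)) where

        reached? : ∀ v → Dec (∃ λ w → Exposable w × T (adj G w v))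
        reached? v = Fin.any? λ w → exposable? w ×-dec T? (adj G w v)

        χ ψ : Fin n → Bool
        χ w = does (exposable? w)
        ψ v = does (reached? v)

        χ-ψ-edge : ∀ {w v} → χ w ≡ true → adj G w v ≡ true → ψ v ≡ true
        χ-ψ-edge {w} {v} χw w∼v with exposable? w | reached? v
        ... | yes _    | yes _   = ≡.refl
        ... | yes w-ex | no  v∉N = ⊥-elim (v∉N (w , w-ex , Equivalence.from T-≡ w∼v))

        ψ-column : ∀ v → 𝟙 (ψ v) ≤ 𝟙 (ψ v) * sum (λ u → f u v)
        ψ-column v with reached? v
        ... | no  _                = inj₂ (sym (zeroˡ _))
        ... | yes (w , w-ex , w∼v) =
          ≤-respʳ (sym (*-identityˡ _)) (neighbour-saturated w-ex (Equivalence.to T-≡ w∼v))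

        -- By `partner-exposable`, a reached column receives weight of f from exposable rows only.
        ψ≤χ-on-support : ∀ u v → 𝟙 (ψ v) * f u v ≤ 𝟙 (χ u) * f u v
        ψ≤χ-on-support u v with reached? v | exposable? u
        ... | no  _ | c     = ≤-respˡ (sym (zeroˡ _)) (*-nonneg (0≤𝟙 (does c)) (F.nonneg u v))
        ... | yes _ | yes _ = ≤-refl
        ... | yes (w , w-ex , w∼v) | no ¬u-ex with F.nonneg u v
        ...   | inj₁ 0<fuv = ⊥-elim (¬u-ex (partner-exposable w-ex (Equivalence.to T-≡ w∼v) 0<fuv))
        ...   | inj₂ 0≈fuv = inj₂ (trans (*-congˡ (sym 0≈fuv))
                               (trans (zeroʳ _) (sym (zeroˡ _))))

        -- Equivalent to (1 - χ)(1 - r) ≤ 0 for the row sum r: a row that is not exposable is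
        -- saturated, since otherwise f itself exposes it.
        χ-row : ∀ u → 1# + 𝟙 (χ u) * sum (f u) ≤ 𝟙 (χ u) + sum (f u)
        χ-row u with exposable? u
        ... | yes _     = inj₂ (+-congˡ (*-identityˡ _))
        ... | no  ¬u-ex = ≤-respˡ (sym (trans (+-congˡ (zeroˡ _)) (+-identityʳ 1#)))
          (≤-respʳ (sym (+-identityˡ _)) (≮⇒≥ λ row<1 → ¬u-ex (exposed row<1)))

        -- The reached columns are full and fed by exposable rows alone, so their number is at most
        -- the weight of the exposable rows. Every other row has weight at least 1.
        deficiency : fromℕ n + sum (λ v → 𝟙 (ψ v)) ≤ sum (λ u → 𝟙 (χ u)) + total f
        deficiency = begin
          fromℕ n + sum (λ v → 𝟙 (ψ v))
            ≤⟨ +-mono-≤ (inj₂ (sym (sum-replicate n))) (sum-mono-≤ ψ-column) ⟩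
          sum {n} (λ _ → 1#) + sum (λ v → 𝟙 (ψ v) * sum (λ u → f u v))
            ≈⟨ +-congˡ (trans (sum-cong-≋ λ v → *-distribˡ-sum (𝟙 (ψ v)) (λ u → f u v))
                              (∑-comm (λ v u → 𝟙 (ψ v) * f u v))) ⟩
          sum {n} (λ _ → 1#) + sum (λ u → sum λ v → 𝟙 (ψ v) * f u v)
            ≤⟨ +-mono-≤ ≤-refl (sum-mono-≤ λ u → sum-mono-≤ (ψ≤χ-on-support u)) ⟩
          sum {n} (λ _ → 1#) + sum (λ u → sum λ v → 𝟙 (χ u) * f u v)
            ≈⟨ +-congˡ (sum-cong-≋ λ u → sym (*-distribˡ-sum (𝟙 (χ u)) (f u))) ⟩
          sum {n} (λ _ → 1#) + sum (λ u → 𝟙 (χ u) * sum (f u))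
            ≈⟨ ∑-distrib-+ (λ _ → 1#) (λ u → 𝟙 (χ u) * sum (f u)) ⟨
          sum (λ u → 1# + 𝟙 (χ u) * sum (f u))
            ≤⟨ sum-mono-≤ χ-row ⟩
          sum (λ u → 𝟙 (χ u) + sum (f u))
            ≈⟨ ∑-distrib-+ (λ u → 𝟙 (χ u)) (λ u → sum (f u)) ⟩
          sum (λ u → 𝟙 (χ u)) + total f ∎
          where open ≤-Reasoning

-- The fractional Tutte-Berge inequality and the resulting test vectors.

module IsolatedVertices (ℝ : CompleteOrderedField) where
  open Reals ℝ
  open OrderedField ℝ
  open QuadraticForms ℝ
  open Rayleigh ℝ
  open FractionalMatchings ℝ

  fromℕ-nonneg : ∀ n → 0# ≤ fromℕ n
  fromℕ-nonneg zero    = ≤-refl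
  fromℕ-nonneg (suc n) = +-nonneg 0≤1 (fromℕ-nonneg n)

  fromℕ-mono : ∀ {m n} → m ℕ.≤ n → fromℕ m ≤ fromℕ n
  fromℕ-mono (z≤n {n})   = fromℕ-nonneg n
  fromℕ-mono (s≤s m≤n) = +-mono-≤ ≤-refl (fromℕ-mono m≤n)

  fromℕ-∣tabulate∣ : ∀ {n} (b : Fin n → Bool) → fromℕ ∣ tabulate b ∣ ≈ sum (λ i → 𝟙 (b i))
  fromℕ-∣tabulate∣ {zero}  b = refl
  fromℕ-∣tabulate∣ {suc n} b with b zero
  ... | true  = +-congˡ (fromℕ-∣tabulate∣ (λ i → b (suc i)))
  ... | false = trans (fromℕ-∣tabulate∣ (λ i → b (suc i))) (sym (+-identityˡ _))

  module _ {n} (G : SimpleGraph n) where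

    -- I is a set of isolated vertices of G - S.
    record Isolates (S I : Fin n → Bool) : Set where
      field
        neighbour : ∀ {u v} → I u ≡ true → adj G u v ≡ true → S v ≡ true
        disjoint  : ∀ {u} → I u ≡ true → S u ≡ false

    module _ {f} (f-fm : IsFractionalMatching G f)
             (f-max : ∀ h → IsFractionalMatching G h → size G h ≤ size G f) where
      open Maximal G f-fm f-max

      -- Deciding `Exposable` at all n vertices is possible under a double negation, which is enough
      -- for deriving a contradiction later.
      fractional-berge : ¬ ¬ (∃ λ S → ∃ λ I → Isolates S I ×
        fromℕ n + sum (λ v → 𝟙 (S v)) ≤ sum (λ u → 𝟙 (I u)) + total f)
      fractional-berge = ¬¬-map witness (Fin.sequence rawApplicative λ w → ¬¬-excluded-middle)
        where
        open RawMonad ¬¬-Monad using (rawApplicative)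
        witness : (∀ w → Dec (Exposable w)) → _
        witness exposable? = S , I , isolates , bound
          where
          open Deficiency exposable?
          -- Dropping the vertices common to χ and ψ preserves the difference of the two
          -- cardinalities and makes S and I disjoint.
          S I : Fin n → Bool
          S v = ψ v ∧ not (χ v)
          I v = χ v ∧ not (ψ v)
          I⇒χ : ∀ {u} → I u ≡ true → χ u ≡ true × ψ u ≡ false
          I⇒χ {u} Iu with χ u | ψ u
          ... | true | false = ≡.refl , ≡.refl
          isolates : Isolates S I
          isolates .Isolates.neighbour {u} {v} Iu u∼v with I⇒χ Iu
          ... | χu , ψu with χ v in χv
          ...   | false rewrite χ-ψ-edge χu u∼v = ≡.refl
          -- Were v exposable, its neighbour u would be reached, which membership in I excludes.
          ...   | true  with () ← ≡.trans (≡.sym ψu) (χ-ψ-edge χv (≡.trans (adj-sym G v u) u∼v))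
          isolates .Isolates.disjoint Iu with I⇒χ Iu
          ... | _ , ψu rewrite ψu = ≡.refl
          same-difference : ∀ p q → 𝟙 (q ∧ not p) + 𝟙 p ≈ 𝟙 (p ∧ not q) + 𝟙 q
          same-difference true  true  = refl
          same-difference true  false = +-comm _ _
          same-difference false true  = +-comm _ _
          same-difference false false = refl
          sums : sum (λ v → 𝟙 (S v)) + sum (λ v → 𝟙 (χ v)) ≈ sum (λ v → 𝟙 (I v)) + sum (λ v → 𝟙 (ψ v))
          sums = trans (sym (∑-distrib-+ (λ v → 𝟙 (S v)) (λ v → 𝟙 (χ v))))
            (trans (sum-cong-≋ λ v → same-difference (χ v) (ψ v))
              (∑-distrib-+ (λ v → 𝟙 (I v)) (λ v → 𝟙 (ψ v))))
          bound : fromℕ n + sum (λ v → 𝟙 (S v)) ≤ sum (λ u → 𝟙 (I u)) + total f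
          bound = x≤x+d (x≤y⇒0≤y-x deficiency) (begin
            t + total f
              ≈⟨ solve 3 (λ t ψ f → t :+ f := (t :+ ψ) :+ (f :- ψ)) refl t p (total f) ⟩
            (t + p) + (total f - p)
              ≈⟨ +-congʳ sums ⟨
            (s + c) + (total f - p)
              ≈⟨ solve 5 (λ s c f p n → (s :+ c) :+ (f :- p) := (n :+ s) :+ ((c :+ f) :- (n :+ p)))
                   refl s c (total f) p (fromℕ n) ⟩
            (fromℕ n + s) + ((c + total f) - (fromℕ n + p)) ∎)
            where
            open SetoidReasoning setoid
            s t c p : Carrier
            s = sum (λ v → 𝟙 (S v))
            t = sum (λ v → 𝟙 (I v))
            c = sum (λ v → 𝟙 (χ v))
            p = sum (λ v → 𝟙 (ψ v))

    -- The quadratic form of aD + A on a test vector.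

    aD+A-sym : ∀ a → Symmetric (aD+A G a)
    aD+A-sym a i j = +-cong (*-congˡ diagonal) (reflexive (≡.cong 𝟙 (adj-sym G i j)))
      where
      diagonal : degreeMatrix G i j ≈ degreeMatrix G j i
      diagonal with i Fin.≟ j | j Fin.≟ i
      ... | yes ≡.refl | yes _   = refl
      ... | no  _      | no  _   = refl
      ... | yes i≡j    | no  j≢i = ⊥-elim (j≢i (≡.sym i≡j))
      ... | no  i≢j    | yes j≡i = ⊥-elim (i≢j (≡.sym j≡i))

    -- The degree of u is a sum over its neighbours, so the diagonal term spreads over the ordered
    -- pairs (u, v) of adjacent vertices.
    aD+A-form : ∀ a z → quadraticForm (aD+A G a) z ≈
      sum (λ u → sum λ v → 𝟙 (adj G u v) * (a * (z u * z u) + z u * z v))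
    aD+A-form a z = sum-cong-≋ λ u → begin
      z u * aD+A G a u · z
        ≈⟨ *-congˡ (trans (·-+ˡ (λ v → a * degreeMatrix G u v) (adjacencyMatrix G u) z)
             (+-congʳ (trans (·-scaleˡ a (degreeMatrix G u) z)
               (*-congˡ (diagonal-· (λ v → fromℕ (degree G v)) z u))))) ⟩
      z u * (a * (fromℕ (degree G u) * z u) + adjacencyMatrix G u · z)
        ≈⟨ solve 4 (λ z a d q → z :* (a :* (d :* z) :+ q) := a :* (z :* z) :* d :+ z :* q)
             refl (z u) a (fromℕ (degree G u)) _ ⟩
      a * (z u * z u) * fromℕ (degree G u) + z u * adjacencyMatrix G u · z
        ≈⟨ +-cong (trans (*-congˡ (fromℕ-∣tabulate∣ (adj G u)))
             (*-distribˡ-sum (a * (z u * z u)) (λ v → 𝟙 (adj G u v))))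
             (*-distribˡ-sum (z u) (λ v → 𝟙 (adj G u v) * z v)) ⟩
      sum (λ v → a * (z u * z u) * 𝟙 (adj G u v)) + sum (λ v → z u * (𝟙 (adj G u v) * z v))
        ≈⟨ ∑-distrib-+ (λ v → a * (z u * z u) * 𝟙 (adj G u v)) (λ v → z u * (𝟙 (adj G u v) * z v)) ⟨
      sum (λ v → a * (z u * z u) * 𝟙 (adj G u v) + z u * (𝟙 (adj G u v) * z v))
        ≈⟨ sum-cong-≋ (λ v → solve 4 (λ a x e y → a :* (x :* x) :* e :+ x :* (e :* y) :=
             e :* (a :* (x :* x) :+ x :* y)) refl a (z u) (𝟙 (adj G u v)) (z v)) ⟩
      sum (λ v → 𝟙 (adj G u v) * (a * (z u * z u) + z u * z v)) ∎
      where open SetoidReasoning setoid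

    module TestVector {S I} (isolates : Isolates S I) {a x y : Carrier}
                      (0≤a : 0# ≤ a) (0≤x : 0# ≤ x) (0≤y : 0# ≤ y) where
      open Isolates isolates

      z : Vector Carrier n
      z u = x * 𝟙 (S u) + y * 𝟙 (I u)

      z-nonneg : ∀ u → 0# ≤ z u
      z-nonneg u = +-nonneg (*-nonneg 0≤x (0≤𝟙 (S u))) (*-nonneg 0≤y (0≤𝟙 (I u)))

      on-I : ∀ {u} → I u ≡ true → z u ≈ y
      on-I {u} Iu rewrite disjoint Iu | Iu =
        solve 2 (λ x y → x :* :0 :+ y :* :1 := y) refl x y

      on-S : ∀ {u} → I u ≡ false → S u ≡ true → z u ≈ x
      on-S Iu Su rewrite Iu | Su = solve 2 (λ x y → x :* :1 :+ y :* :0 := x) refl x y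

      z·z : z · z ≈ x * x * sum (λ u → 𝟙 (S u)) + y * y * sum (λ u → 𝟙 (I u))
      z·z = trans (sum-cong-≋ λ u → square u) (trans
        (∑-distrib-+ (λ u → x * x * 𝟙 (S u)) (λ u → y * y * 𝟙 (I u)))
        (+-cong (sym (*-distribˡ-sum (x * x) (λ u → 𝟙 (S u))))
                (sym (*-distribˡ-sum (y * y) (λ u → 𝟙 (I u))))))
        where
        square : ∀ u → z u * z u ≈ x * x * 𝟙 (S u) + y * y * 𝟙 (I u)
        square u = square′ (I u) ≡.refl (S u) ≡.refl
          where
          square′ : ∀ p → I u ≡ p → ∀ q → S u ≡ q → z u * z u ≈ x * x * 𝟙 q + y * y * 𝟙 p
          square′ true  Iu true  Su with () ← ≡.trans (≡.sym (disjoint Iu)) Su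
          square′ true  Iu false Su = trans (*-cong (on-I Iu) (on-I Iu))
            (solve 2 (λ x y → y :* y := x :* x :* :0 :+ y :* y :* :1) refl x y)
          square′ false Iu true  Su = trans (*-cong (on-S Iu Su) (on-S Iu Su))
            (solve 2 (λ x y → x :* x := x :* x :* :1 :+ y :* y :* :0) refl x y)
          square′ false Iu false Su rewrite Iu | Su =
            solve 2 (λ x y → (x :* :0 :+ y :* :0) :* (x :* :0 :+ y :* :0)
              := x :* x :* :0 :+ y :* y :* :0) refl x y

      -- Summands of `aD+A-form` at an adjacent pair (u, v): α for u in I and v in S, β for u in S
      -- and v in I.
      α β : Carrier
      α = a * (y * y) + x * y
      β = a * (x * x) + x * y

      edges : Carrier
      edges = sum λ u → sum λ v → 𝟙 (adj G u v) * 𝟙 (I u)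

      edges′ : sum (λ u → sum λ v → 𝟙 (adj G u v) * 𝟙 (I v)) ≈ edges
      edges′ = trans (∑-comm (λ u v → 𝟙 (adj G u v) * 𝟙 (I v)))
        (sum-cong-≋ λ v → sum-cong-≋ λ u →
          *-congʳ (reflexive (≡.cong 𝟙 (adj-sym G u v))))

      -- Neighbours of I lie in S, which is disjoint from I, so an edge meeting I has one end in
      -- each and attains equality. Any other edge contributes a nonnegative amount.
      edge-bound : ∀ u v → 𝟙 (adj G u v) * 𝟙 (I u) * α + 𝟙 (adj G u v) * 𝟙 (I v) * β ≤
                           𝟙 (adj G u v) * (a * (z u * z u) + z u * z v)
      edge-bound u v = bound (adj G u v) ≡.refl (I u) ≡.refl (I v) ≡.refl
        where
        bound : ∀ e → adj G u v ≡ e → ∀ p → I u ≡ p → ∀ q → I v ≡ q →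
                𝟙 e * 𝟙 p * α + 𝟙 e * 𝟙 q * β ≤ 𝟙 e * (a * (z u * z u) + z u * z v)
        bound false _ p _ q _ = inj₂ (solve 5 (λ p q α β r →
          :0 :* p :* α :+ :0 :* q :* β := :0 :* r) refl (𝟙 p) (𝟙 q) α β _)
        bound true u∼v true Iu true Iv with () ← ≡.trans (≡.sym (disjoint Iv)) (neighbour Iu u∼v)
        bound true u∼v true Iu false Iv = inj₂ (trans
          (solve 2 (λ α β → :1 :* :1 :* α :+ :1 :* :0 :* β := :1 :* α) refl α β)
          (*-congˡ (sym (+-cong (*-congˡ (*-cong zu zu)) (trans (*-cong zu zv) (*-comm y x))))))
          where
          zu = on-I Iu
          zv = on-S Iv (neighbour Iu u∼v)
        bound true u∼v false Iu true Iv = inj₂ (trans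
          (solve 2 (λ α β → :1 :* :0 :* α :+ :1 :* :1 :* β := :1 :* β) refl α β)
          (*-congˡ (sym (+-cong (*-congˡ (*-cong zu zu)) (*-cong zu zv)))))
          where
          zv = on-I Iv
          zu = on-S Iu (neighbour Iv (≡.trans (adj-sym G v u) u∼v))
        bound true u∼v false _ false _ = ≤-respˡ
          (solve 2 (λ α β → :0 := :1 :* :0 :* α :+ :1 :* :0 :* β) refl α β)
          (*-nonneg 0≤1 (+-nonneg (*-nonneg 0≤a (square-nonneg (z u)))
            (*-nonneg (z-nonneg u) (z-nonneg v))))

      form-bound : edges * (α + β) ≤ quadraticForm (aD+A G a) z
      form-bound = begin
        edges * (α + β)
          ≈⟨ distribˡ edges α β ⟩
        edges * α + edges * β
          ≈⟨ +-congˡ (*-congʳ edges′) ⟨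
        edges * α + sum (λ u → sum λ v → 𝟙 (adj G u v) * 𝟙 (I v)) * β
          ≈⟨ +-cong (total-*ʳ (λ u v → 𝟙 (adj G u v) * 𝟙 (I u)) α)
                    (total-*ʳ (λ u v → 𝟙 (adj G u v) * 𝟙 (I v)) β) ⟩
        total (λ u v → 𝟙 (adj G u v) * 𝟙 (I u) * α) + total (λ u v → 𝟙 (adj G u v) * 𝟙 (I v) * β)
          ≈⟨ ⊞-total (λ u v → 𝟙 (adj G u v) * 𝟙 (I u) * α)
                     (λ u v → 𝟙 (adj G u v) * 𝟙 (I v) * β) ⟨
        total (λ u v → 𝟙 (adj G u v) * 𝟙 (I u) * α + 𝟙 (adj G u v) * 𝟙 (I v) * β)
          ≤⟨ sum-mono-≤ (λ u → sum-mono-≤ λ v → edge-bound u v) ⟩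
        total (λ u v → 𝟙 (adj G u v) * (a * (z u * z u) + z u * z v))
          ≈⟨ aD+A-form a z ⟨
        quadraticForm (aD+A G a) z ∎
        where
        open ≤-Reasoning
        total-*ʳ : ∀ (g : Matrix n) c → total g * c ≈ total (λ u v → g u v * c)
        total-*ʳ g c = trans (*-distribʳ-sum c (λ u → sum (g u)))
                             (sum-cong-≋ λ u → *-distribʳ-sum c (g u))

      edges-bound : ∀ {δ} → IsMinDegree G δ → fromℕ δ * sum (λ u → 𝟙 (I u)) ≤ edges
      edges-bound {δ} (_ , δ-min) = begin
        fromℕ δ * sum (λ u → 𝟙 (I u))
          ≈⟨ *-distribˡ-sum (fromℕ δ) (λ u → 𝟙 (I u)) ⟩
        sum (λ u → fromℕ δ * 𝟙 (I u))
          ≤⟨ sum-mono-≤ (λ u → *-monoˡ-≤ (0≤𝟙 (I u)) (fromℕ-mono (δ-min u))) ⟩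
        sum (λ u → fromℕ (degree G u) * 𝟙 (I u))
          ≈⟨ sum-cong-≋ (λ u → trans (*-congʳ (fromℕ-∣tabulate∣ (adj G u)))
               (*-distribʳ-sum (𝟙 (I u)) (λ v → 𝟙 (adj G u v)))) ⟩
        edges ∎
        where open ≤-Reasoning

      rayleigh-bound : ∀ {δ λ₁} → IsMinDegree G δ → IsLargestEigenvalue (aD+A G a) λ₁ →
        fromℕ δ * sum (λ u → 𝟙 (I u)) * (a * (x * x) + a * (y * y) + 2# * (x * y)) ≤
        λ₁ * (x * x * sum (λ u → 𝟙 (S u)) + y * y * sum (λ u → 𝟙 (I u)))
      rayleigh-bound {δ} {λ₁} δ-min λ₁-largest = begin
        fromℕ δ * sum (λ u → 𝟙 (I u)) * (a * (x * x) + a * (y * y) + 2# * (x * y))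
          ≈⟨ *-congˡ (solve 3 (λ a x y →
               a :* (x :* x) :+ a :* (y :* y) :+ (:1 :+ :1) :* (x :* y) :=
               (a :* (y :* y) :+ x :* y) :+ (a :* (x :* x) :+ x :* y)) refl a x y) ⟩
        fromℕ δ * sum (λ u → 𝟙 (I u)) * (α + β)
          ≤⟨ *-monoˡ-≤ (+-nonneg (+-nonneg (*-nonneg 0≤a (square-nonneg y)) (*-nonneg 0≤x 0≤y))
                                 (+-nonneg (*-nonneg 0≤a (square-nonneg x)) (*-nonneg 0≤x 0≤y)))
                       (edges-bound δ-min) ⟩
        edges * (α + β)
          ≤⟨ form-bound ⟩
        quadraticForm (aD+A G a) z
          ≤⟨ rayleigh (aD+A G a) (aD+A-sym a) λ₁-largest z ⟩
        λ₁ * z · z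
          ≈⟨ *-congˡ z·z ⟩
        λ₁ * (x * x * sum (λ u → 𝟙 (S u)) + y * y * sum (λ u → 𝟙 (I u))) ∎
        where open ≤-Reasoning

-- From test vectors to the three cases of φ.

module SpectralBound (ℝ : CompleteOrderedField) where
  open Reals ℝ
  open OrderedField ℝ
  open FractionalMatchings ℝ
  open IsolatedVertices ℝ

  √-square : ∀ {x} → 0# ≤ x → 0# ≤ √ x × √ x * √ x ≈ x
  √-square {x} 0≤x with 0# ≤? x
  ... | yes 0≤x′ = proj₂ (sqrt-exists 0≤x′)
  ... | no  0≰x  = ⊥-elim (0≰x 0≤x)

  fromℕ-2 : fromℕ 2 ≈ 2#
  fromℕ-2 = +-congˡ (+-identityʳ 1#)

  x/y≤z : ∀ {x y z} → 0# < y → x ≤ y * z → x / y ≤ z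
  x/y≤z 0<y x≤yz = *-cancelˡ-≤ 0<y (≤-respˡ (sym (x*y/y≈x _ 0<y)) x≤yz)

  -- With s = |S| and t = |I| the bound of the test vector depends on t/s
  -- only, and t/s ≥ (N + k)/(N - k) since s + t ≤ N and t ≥ s + k.
  normalize : ∀ {N k s t D a μ x y} → 0# < k → k < N → 0# ≤ a → 0# ≤ D → 0# ≤ s →
    s + k ≤ t → s + t ≤ N →
    (∀ x y → 0# ≤ x → 0# ≤ y →
      D * t * (a * (x * x) + a * (y * y) + 2# * (x * y)) ≤ μ * (x * x * s + y * y * t)) →
    0# ≤ x → 0# ≤ y →
    D * (N + k) * (a * (x * x) + a * (y * y) + 2# * (x * y)) ≤
    μ * (x * x * (N - k) + y * y * (N + k))
  normalize {N} {k} {s} {t} {D} {a} {μ} {x} {y}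
            0<k k<N 0≤a 0≤D 0≤s s+k≤t s+t≤N bound 0≤x 0≤y = *-cancelˡ-≤ 0<t (begin
    t * (D * (N + k) * Q)
      ≈⟨ solve 4 (λ t D M Q → t :* (D :* M :* Q) := M :* (D :* t :* Q)) refl t D (N + k) Q ⟩
    (N + k) * (D * t * Q)
      ≤⟨ *-monoʳ-≤ 0≤N+k (bound x y 0≤x 0≤y) ⟩
    (N + k) * (μ * (x * x * s + y * y * t))
      ≈⟨ solve 6 (λ M μ X Y s t → M :* (μ :* (X :* s :+ Y :* t)) :=
           μ :* (X :* (M :* s)) :+ μ :* (Y :* (M :* t))) refl (N + k) μ (x * x) (y * y) s t ⟩
    μ * (x * x * ((N + k) * s)) + μ * (y * y * ((N + k) * t))
      ≤⟨ +-mono-≤ (*-monoʳ-≤ 0≤μ (*-monoʳ-≤ (square-nonneg x) ratio)) ≤-refl ⟩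
    μ * (x * x * ((N - k) * t)) + μ * (y * y * ((N + k) * t))
      ≈⟨ solve 6 (λ P M μ X Y t → μ :* (X :* (P :* t)) :+ μ :* (Y :* (M :* t)) :=
           t :* (μ :* (X :* P :+ Y :* M))) refl (N - k) (N + k) μ (x * x) (y * y) t ⟩
    t * (μ * (x * x * (N - k) + y * y * (N + k))) ∎)
    where
    open ≤-Reasoning
    Q : Carrier
    Q = a * (x * x) + a * (y * y) + 2# * (x * y)
    0<t : 0# < t
    0<t = <-≤-trans (<-respʳ-≈ (+-comm k s) (+-pos 0<k 0≤s)) s+k≤t
    0<N : 0# < N
    0<N = <-trans 0<k k<N
    0≤N+k : 0# ≤ N + k
    0≤N+k = inj₁ (+-pos 0<N (inj₁ 0<k))
    -- The choice x = 0, y = 1 gives D t a ≤ t μ.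
    0≤μ : 0# ≤ μ
    0≤μ = *-cancelˡ-≤ 0<t (≤-trans (≤-respˡ (sym (zeroʳ t)) (*-nonneg (*-nonneg 0≤D (inj₁ 0<t)) 0≤a))
      (begin
        D * t * a
          ≈⟨ solve 3 (λ D t a → D :* t :* a := D :* t :*
               (a :* (:0 :* :0) :+ a :* (:1 :* :1) :+ (:1 :+ :1) :* (:0 :* :1))) refl D t a ⟩
        D * t * (a * (0# * 0#) + a * (1# * 1#) + 2# * (0# * 1#))
          ≤⟨ bound 0# 1# ≤-refl 0≤1 ⟩
        μ * (0# * 0# * s + 1# * 1# * t)
          ≈⟨ solve 3 (λ μ s t → μ :* (:0 :* :0 :* s :+ :1 :* :1 :* t) := t :* μ) refl μ s t ⟩
        t * μ ∎))
    -- The difference combines the slacks of s + k ≤ t and s + t ≤ N with weights N and k.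
    ratio : (N + k) * s ≤ (N - k) * t
    ratio = x≤x+d
      (+-nonneg (*-nonneg (inj₁ 0<N) (x≤y⇒0≤y-x s+k≤t)) (*-nonneg (inj₁ 0<k) (x≤y⇒0≤y-x s+t≤N)))
      (solve 4 (λ N k s t → (N :- k) :* t :=
        (N :+ k) :* s :+ (N :* (t :- (s :+ k)) :+ k :* (N :- (s :+ t)))) refl N k s t)

  -- With m = N - k and M = N + k, the ratio x : y is √(M/m) : 1 for a = 0, M : m for 0 < a ≤ 1, and
  -- 1 : 0 for a > 1.
  φ-bound : ∀ {a n δ k μ} → 0# ≤ a → 0# < k → k < fromℕ n →
    (∀ x y → 0# ≤ x → 0# ≤ y →
      fromℕ δ * (fromℕ n + k) * (a * (x * x) + a * (y * y) + 2# * (x * y)) ≤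
      μ * (x * x * (fromℕ n - k) + y * y * (fromℕ n + k))) →
    φ a n δ k ≤ μ
  φ-bound {a} {n} {δ} {k} {μ} 0≤a 0<k k<n bound = cases (a ≟ 0#) (a ≤? 1#)
    where
    open ≤-Reasoning
    N D m M r : Carrier
    N = fromℕ n
    D = fromℕ δ
    m = N - k
    M = N + k
    r = √ (1# + fromℕ 2 * k / m)
    0<m : 0# < m
    0<m = x<y⇒0<y-x k<n
    0<N : 0# < N
    0<N = <-trans 0<k k<n
    0<M : 0# < M
    0<M = +-pos 0<N (inj₁ 0<k)
    0≤D : 0# ≤ D
    0≤D = fromℕ-nonneg δ

    0≤ratio : 0# ≤ 1# + fromℕ 2 * k / m
    0≤ratio = +-nonneg 0≤1 (inj₁ (/-pos (*-pos (<-respʳ-≈ (sym fromℕ-2) 0<2) 0<k) 0<m))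
    0≤r : 0# ≤ r
    0≤r = proj₁ (√-square 0≤ratio)
    r²m≈M : r * r * m ≈ M
    r²m≈M = begin-equality
      r * r * m                          ≈⟨ *-congʳ (proj₂ (√-square 0≤ratio)) ⟩
      (1# + fromℕ 2 * k / m) * m         ≈⟨ solve 2 (λ q m → (:1 :+ q) :* m := m :+ m :* q) refl (fromℕ 2 * k / m) m ⟩
      m + m * (fromℕ 2 * k / m)          ≈⟨ +-congˡ (trans (x*y/y≈x _ 0<m) (*-congʳ fromℕ-2)) ⟩
      m + 2# * k                         ≈⟨ solve 2 (λ N k → (N :- k) :+ (:1 :+ :1) :* k := N :+ k) refl N k ⟩
      M                                  ∎

    -- Since r² m = M, the choice x = r, y = 1 balances the two terms on the right of `bound`. The
    -- terms with a on the left are nonnegative.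
    case₀ : D * r ≤ μ
    case₀ = *-cancelˡ-≤ (*-pos 0<2 0<M) (begin
      2# * M * (D * r)
        ≤⟨ x≤x+d (*-nonneg (*-nonneg 0≤D (inj₁ 0<M)) (*-nonneg 0≤a (+-nonneg (square-nonneg r) 0≤1)))
             (solve 4 (λ D M a r →
               D :* M :* (a :* (r :* r) :+ a :* (:1 :* :1) :+ (:1 :+ :1) :* (r :* :1)) :=
               (:1 :+ :1) :* M :* (D :* r) :+ D :* M :* (a :* (r :* r :+ :1))) refl D M a r) ⟩
      D * M * (a * (r * r) + a * (1# * 1#) + 2# * (r * 1#))
        ≤⟨ bound r 1# 0≤r 0≤1 ⟩
      μ * (r * r * m + 1# * 1# * M)
        ≈⟨ *-congˡ (+-congʳ r²m≈M) ⟩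
      μ * (M + 1# * 1# * M)
        ≈⟨ solve 2 (λ μ M → μ :* (M :+ :1 :* :1 :* M) := (:1 :+ :1) :* M :* μ) refl μ M ⟩
      2# * M * μ ∎)

    -- As M + m = 2 N, a (M² + m²) + 2 M m equals 4 a N² + 2 (1 - a) M m, and a ≤ 1 makes the last
    -- term nonnegative.
    case₁ : a ≤ 1# → fromℕ 2 * a * D * N / m ≤ μ
    case₁ a≤1 = x/y≤z 0<m (*-cancelˡ-≤ (*-pos 0<M (*-pos 0<2 0<N)) (begin
      M * (2# * N) * (fromℕ 2 * a * D * N)
        ≈⟨ *-congˡ (*-congʳ (*-congʳ (*-congʳ fromℕ-2))) ⟩
      M * (2# * N) * (2# * a * D * N)
        ≤⟨ x≤x+d (*-nonneg (*-nonneg 0≤D (inj₁ 0<M)) (*-nonneg (inj₁ 0<2)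
                   (*-nonneg (x≤y⇒0≤y-x a≤1) (inj₁ (*-pos 0<M 0<m)))))
             (solve 4 (λ D N k a → let M = N :+ k; m = N :- k in
               D :* M :* (a :* (M :* M) :+ a :* (m :* m) :+ (:1 :+ :1) :* (M :* m)) :=
               M :* ((:1 :+ :1) :* N) :* ((:1 :+ :1) :* a :* D :* N) :+
               D :* M :* ((:1 :+ :1) :* ((:1 :- a) :* (M :* m)))) refl D N k a) ⟩
      D * M * (a * (M * M) + a * (m * m) + 2# * (M * m))
        ≤⟨ bound M m (inj₁ 0<M) (inj₁ 0<m) ⟩
      μ * (M * M * m + m * m * M)
        ≈⟨ solve 3 (λ μ N k → let M = N :+ k; m = N :- k in
             μ :* (M :* M :* m :+ m :* m :* M) := M :* ((:1 :+ :1) :* N) :* (m :* μ)) refl μ N k ⟩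
      M * (2# * N) * (m * μ) ∎))

    -- Here the test vector is supported on S alone.
    case₂ : a * D * M / m ≤ μ
    case₂ = x/y≤z 0<m (begin
      a * D * M
        ≈⟨ solve 3 (λ a D M → a :* D :* M :=
             D :* M :* (a :* (:1 :* :1) :+ a :* (:0 :* :0) :+ (:1 :+ :1) :* (:1 :* :0))) refl a D M ⟩
      D * M * (a * (1# * 1#) + a * (0# * 0#) + 2# * (1# * 0#))
        ≤⟨ bound 1# 0# 0≤1 ≤-refl ⟩
      μ * (1# * 1# * m + 0# * 0# * M)
        ≈⟨ solve 3 (λ μ m M → μ :* (:1 :* :1 :* m :+ :0 :* :0 :* M) := m :* μ) refl μ m M ⟩
      m * μ ∎)

    -- Abstracting over both decisions lets the conditionals of `φ` reduce.
    cases : (a≟0 : Dec (a ≈ 0#)) (a≤?1 : Dec (a ≤ 1#)) →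
      (if does a≟0 then D * r
       else if does a≤?1 then fromℕ 2 * a * D * N / m
       else a * D * M / m) ≤ μ
    cases (yes _) _         = case₀
    cases (no  _) (yes a≤1) = case₁ a≤1
    cases (no  _) (no  _)   = case₂

theorem1p3 : (ℝ : CompleteOrderedField) → let open Reals ℝ in
    (n : ℕ) (G : SimpleGraph n) → Connected G →
    (δ : ℕ) → IsMinDegree G δ →
    (a : Carrier) → 0# ≤ a →
    (k : Carrier) → 0# < k → k < fromℕ n →
    fromℕ δ ≤ (fromℕ n - k) / fromℕ 2 →
    (λ₁ : Carrier) → IsLargestEigenvalue (aD+A G a) λ₁ →
    λ₁ < φ a n δ k →
    (μf : Carrier) → IsFractionalMatchingNumber G μf →
    (fromℕ n - k) / fromℕ 2 < μf
theorem1p3 ℝ n G _ δ δ-min a 0≤a k 0<k k<n _ λ₁ λ₁-largest λ₁<φ μf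
           ((f , f-fm , size-f≈μf) , μf-upper) =
  -- Under the assumption `μf≤` the goal is a contradiction, so `fractional-berge` can be applied
  -- despite its double negation; φ ≤ λ₁ then refutes `λ₁<φ`.
  ≰⇒> λ μf≤ → fractional-berge G f-fm f-max λ (S , I , isolates , deficiency) →
    <⇒≱ λ₁<φ (φ-bound {n = n} {δ} 0≤a 0<k k<n λ x y 0≤x 0≤y →
      normalize 0<k k<n 0≤a (fromℕ-nonneg δ)
        (sum-nonneg λ u → 0≤𝟙 (S u))
        (surplus S I deficiency μf≤)
        (cardinalities isolates)
        (λ x y 0≤x 0≤y → TestVector.rayleigh-bound G isolates 0≤a 0≤x 0≤y δ-min λ₁-largest)
        0≤x 0≤y)
  where
  open Reals ℝ
  open OrderedField ℝ
  open FractionalMatchings ℝ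
  open IsolatedVertices ℝ
  open SpectralBound ℝ
  open ≤-Reasoning

  f-max : ∀ h → IsFractionalMatching G h → size G h ≤ size G f
  f-max h h-fm = ≤-respʳ (sym size-f≈μf) (μf-upper h h-fm)

  total≤ : μf ≤ (fromℕ n - k) / fromℕ 2 → total f ≤ fromℕ n - k
  total≤ μf≤ = begin
    total f                              ≈⟨ size-total G f-fm ⟩
    2# * size G f                        ≈⟨ *-cong (sym fromℕ-2) size-f≈μf ⟩
    fromℕ 2 * μf                         ≤⟨ *-monoʳ-≤ (fromℕ-nonneg 2) μf≤ ⟩
    fromℕ 2 * ((fromℕ n - k) / fromℕ 2)  ≈⟨ x*y/y≈x _ (<-respʳ-≈ (sym fromℕ-2) 0<2) ⟩
    fromℕ n - k                          ∎

  -- The difference of the cardinalities of I and S is at least n - `total f`, and `total f` is at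
  -- most n - k.
  surplus : ∀ S I → fromℕ n + sum (λ v → 𝟙 (S v)) ≤ sum (λ u → 𝟙 (I u)) + total f →
            μf ≤ (fromℕ n - k) / fromℕ 2 →
            sum (λ v → 𝟙 (S v)) + k ≤ sum (λ u → 𝟙 (I u))
  surplus S I deficiency μf≤ = x≤x+d
    (+-nonneg (x≤y⇒0≤y-x deficiency) (x≤y⇒0≤y-x (total≤ μf≤)))
    (solve 5 (λ N k s t F → t :=
      (s :+ k) :+ (((t :+ F) :- (N :+ s)) :+ ((N :- k) :- F)))
      refl (fromℕ n) k (sum (λ v → 𝟙 (S v))) (sum (λ u → 𝟙 (I u))) (total f))

  cardinalities : ∀ {S I} → Isolates G S I →
                  sum (λ v → 𝟙 (S v)) + sum (λ u → 𝟙 (I u)) ≤ fromℕ n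
  cardinalities {S} {I} isolates = begin
    sum (λ v → 𝟙 (S v)) + sum (λ u → 𝟙 (I u))  ≈⟨ ∑-distrib-+ (λ v → 𝟙 (S v)) (λ u → 𝟙 (I u)) ⟨
    sum (λ u → 𝟙 (S u) + 𝟙 (I u))              ≤⟨ sum-mono-≤ (λ u → one u (I u) ≡.refl) ⟩
    sum {n} (λ _ → 1#)                         ≈⟨ sum-replicate n ⟩
    fromℕ n                                    ∎
    where
    one : ∀ u p → I u ≡ p → 𝟙 (S u) + 𝟙 p ≤ 1#
    one u true  Iu = inj₂ (trans
      (+-congʳ (reflexive (≡.cong 𝟙 (Isolates.disjoint isolates Iu)))) (+-identityˡ 1#))
    one u false _  = ≤-respˡ (sym (+-identityʳ _)) (𝟙≤1 (S u))
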